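{- Let $\zeta(m,r,s)$ (written $\zeta(r)$) be the formal power series in $r$ satisfying $$1=(1+rs(m-2))\zeta(r)+rs\,\zeta(r)\zeta(rs)+rs(1+rs^2(m-1))\zeta(r)\zeta(rs)\zeta(rs^2)+r^2s^3\zeta(r)\zeta(rs)\zeta(rs^2)\zeta(rs^3).$$ Then at $m=1$, $$\zeta(1,r,s)=\sum_{n\ge 0}(-rs)^{n}\sum_{\mu\in\mathtt{Dyck}(n;2)}s^{\mathrm{Area}(\mu)}.$$
   Context: A $2$-Dyck path of size $n$ is a lattice path from $(0,0)$ to $(2n,n)$ consisting of up steps $U=(0,1)$ and down steps $D=(1,0)$ which never goes below the line $y=x/2$; $\mathtt{Dyck}(n;2)$ is the set of them. $\mathrm{Area}(\mu)$ is the number of unit boxes above the lowest path $\mu_0=(UD^2)^n$ and below $\mu$. Power series in $r$ have coefficients in $\mathbb{Z}[m,s]$. -}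

module Defs where

open import Algebra.Bundles.Raw using (RawRing)
import Algebra.Definitions.RawSemiring as RawSemiringDefs
open import Data.Fin.Base using (toℕ)
open import Data.Integer.Base using (+-*-rawRing)
open import Data.List.Base
  using (List; []; _∷_; [_]; _++_; map; foldr; filter; length; upTo; cartesianProduct)
open import Data.List.Relation.Unary.All using (All; all?)
open import Data.Nat.Base as ℕ using (ℕ; zero; suc; _∸_)
open import Data.Nat.Properties using (_≟_; _≤?_; _<?_)
open import Data.Product.Base using (_×_; _,_)
open import Data.Product.Properties using (≡-dec)
open import Level using (Level)
open import Relation.Binary.PropositionalEquality.Core using (_≡_)
open import Relation.Nullary.Decidable.Core using (_×-dec_)
open import Relation.Unary using (Decidable)

private
  variable
    c ℓ : Level

-- R[x].  A polynomial is its list of coefficients, constant term first.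
-- Trailing zeros are allowed, so equality compares coefficients.
module Polynomial (R : RawRing c ℓ) where
  open RawRing R

  Poly : Set c
  Poly = List Carrier

  coeff : Poly → ℕ → Carrier
  coeff []      _       = 0#
  coeff (a ∷ p) zero    = a
  coeff (a ∷ p) (suc i) = coeff p i

  _≈ₚ_ : Poly → Poly → Set ℓ
  p ≈ₚ q = ∀ i → coeff p i ≈ coeff q i

  _+ₚ_ : Poly → Poly → Poly
  []      +ₚ q       = q
  (a ∷ p) +ₚ []      = a ∷ p
  (a ∷ p) +ₚ (b ∷ q) = (a + b) ∷ (p +ₚ q)

  -- (a + x p) q = a q + x (p q)
  _*ₚ_ : Poly → Poly → Poly
  []      *ₚ q = []
  (a ∷ p) *ₚ q = map (a *_) q +ₚ (0# ∷ (p *ₚ q))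

  const : Carrier → Poly
  const a = [ a ]

  X : Poly
  X = 0# ∷ 1# ∷ []

  eval : Carrier → Poly → Carrier
  eval x = foldr (λ a v → a + x * v) 0#

  rawRing : RawRing c ℓ
  rawRing = record
    { Carrier = Poly
    ; _≈_     = _≈ₚ_
    ; _+_     = _+ₚ_
    ; _*_     = _*ₚ_
    ; -_      = map (-_)
    ; 0#      = []
    ; 1#      = const 1#
    }

-- R[[r]].  A power series is its sequence of coefficients: f stands for
-- Σ_{n≥0} (f n) rⁿ.
module PowerSeries (R : RawRing c ℓ) where
  open RawRing R
  open RawSemiringDefs rawSemiring using (_^_; sum)

  Series : Set c
  Series = ℕ → Carrier

  _≈ₛ_ : Series → Series → Set ℓ
  f ≈ₛ g = ∀ n → f n ≈ g n

  _*ₛ_ : Series → Series → Series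
  (f *ₛ g) n = sum {suc n} (λ i → f (toℕ i) * g (n ∸ toℕ i))

  const : Carrier → Series
  const a zero    = a
  const a (suc n) = 0#

  r : Series
  r 1 = 1#
  r _ = 0#

  -- f ⟨r· a ⟩ is f(ra)
  _⟨r·_⟩ : Series → Carrier → Series
  (f ⟨r· a ⟩) n = f n * a ^ n

  rawRing : RawRing c ℓ
  rawRing = record
    { Carrier = Series
    ; _≈_     = _≈ₛ_
    ; _+_     = λ f g n → f n + g n
    ; _*_     = _*ₛ_
    ; -_      = λ f n → - f n
    ; 0#      = λ _ → 0#
    ; 1#      = const 1#
    }

-- ℤ[m,s] is represented as ℤ[s][m].
module ℤ[s]   = Polynomial +-*-rawRing
module ℤ[m,s] = Polynomial ℤ[s].rawRing

module ℤ[s]⟦r⟧   = PowerSeries ℤ[s].rawRing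
module ℤ[m,s]⟦r⟧ = PowerSeries ℤ[m,s].rawRing

module _ (ζ : ℤ[m,s]⟦r⟧.Series) where
  open RawRing ℤ[m,s]⟦r⟧.rawRing
  open RawSemiringDefs rawSemiring using (_^_)
  open RawSemiringDefs (RawRing.rawSemiring ℤ[m,s].rawRing)
    using () renaming (_^_ to _^ᶜ_)
  open ℤ[m,s]⟦r⟧ using (r; const; _⟨r·_⟩)

  private
    s₀ : ℤ[m,s].Poly
    s₀ = ℤ[m,s].const ℤ[s].X

    m s 2# : Carrier
    m  = const ℤ[m,s].X
    s  = const s₀
    2# = 1# + 1#

    -- ζ⟨rs^ k ⟩ is ζ(r sᵏ)
    ζ⟨rs^_⟩ : ℕ → Carrier
    ζ⟨rs^ k ⟩ = ζ ⟨r· s₀ ^ᶜ k ⟩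

  FunctionalEquation : Set
  FunctionalEquation =
    1# ≈ (1# + r * s * (m + - 2#)) * ζ
       + r * s * ζ * ζ⟨rs^ 1 ⟩
       + r * s * (1# + r * s ^ 2 * (m + - 1#)) * ζ * ζ⟨rs^ 1 ⟩ * ζ⟨rs^ 2 ⟩
       + r ^ 2 * s ^ 3 * ζ * ζ⟨rs^ 1 ⟩ * ζ⟨rs^ 2 ⟩ * ζ⟨rs^ 3 ⟩

atm=1 : ℤ[m,s]⟦r⟧.Series → ℤ[s]⟦r⟧.Series
atm=1 f n = ℤ[m,s].eval (RawRing.1# ℤ[s].rawRing) (f n)

data Step : Set where
  U D : Step

Path : Set
Path = List Step

Point : Set
Point = ℕ × ℕ

move : Step → Point → Point
move U (x , y) = x , suc y
move D (x , y) = suc x , y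

endFrom : Point → Path → Point
endFrom P []      = P
endFrom P (t ∷ μ) = endFrom (move t P) μ

verticesFrom : Point → Path → List Point
verticesFrom P []      = [ P ]
verticesFrom P (t ∷ μ) = P ∷ verticesFrom (move t P) μ

-- A path is never below the line y = x/2 exactly when none of its lattice
-- points is, since along each unit step 2y - x is monotone.
WeaklyAboveLine : Point → Set
WeaklyAboveLine (x , y) = x ℕ.≤ 2 ℕ.* y

IsDyck : ℕ → Path → Set
IsDyck n μ = endFrom (0 , 0) μ ≡ (2 ℕ.* n , n)
           × All WeaklyAboveLine (verticesFrom (0 , 0) μ)

isDyck? : ∀ n → Decidable (IsDyck n)
isDyck? n μ = ≡-dec _≟_ _≟_ (endFrom (0 , 0) μ) (2 ℕ.* n , n)
      ×-dec all? (λ (x , y) → x ≤? 2 ℕ.* y) (verticesFrom (0 , 0) μ)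

-- All paths with the given number of steps, each listed once.
paths : ℕ → List Path
paths zero    = [ [] ]
paths (suc k) = map (U ∷_) (paths k) ++ map (D ∷_) (paths k)

-- A path from (0,0) to (2n,n) has 3n steps.
Dyck : ℕ → List Path
Dyck n = filter (isDyck? n) (paths (3 ℕ.* n))

-- (U D²)ⁿ
lowest : ℕ → Path
lowest zero    = []
lowest (suc n) = U ∷ D ∷ D ∷ lowest n

-- height μ i is the y-coordinate of the down step of μ from x = i to
-- x = i + 1.  The value returned when there is no such step is never used.
height : Path → ℕ → ℕ
height []      i       = 0
height (U ∷ μ) i       = suc (height μ i)
height (D ∷ μ) zero    = 0
height (D ∷ μ) (suc i) = height μ i

-- (i , j) stands for the unit box [i,i+1] × [j,j+1].
Between : Path → Path → Point → Set
Between ν μ (i , j) = height ν i ℕ.≤ j × j ℕ.< height μ i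

between? : ∀ ν μ → Decidable (Between ν μ)
between? ν μ (i , j) = (height ν i ≤? j) ×-dec (j <? height μ i)

-- All boxes between two paths from (0,0) to (2n,n) lie in [0,2n] × [0,n].
Area : ℕ → Path → ℕ
Area n μ = length (filter (between? (lowest n) μ)
                          (cartesianProduct (upTo (2 ℕ.* n)) (upTo n)))

module _ where
  open RawRing ℤ[s].rawRing
  open RawSemiringDefs rawSemiring using (_^_)
  open ℤ[s] using () renaming (X to s)

  -- Σ_{n≥0} (-rs)ⁿ Σ_μ s^Area(μ), whose coefficient of rⁿ is
  -- (-s)ⁿ Σ_μ s^Area(μ).
  dyckSeries : ℤ[s]⟦r⟧.Series
  dyckSeries n =
    (- s) ^ n * foldr _+_ 0# (map (λ μ → s ^ Area n μ) (Dyck n))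

{-# OPTIONS --safe #-}

-- At m = 1 the equation reads G(r) + rs ζ(r) G(rs) = 0 for
-- G(r) = ζ(r) + rs ζ(r) ζ(rs) ζ(rs²) - 1, so G = 0 coefficient by coefficient.
-- Put C_h = s^(⌊0/2⌋ + … + ⌊(h-1)/2⌋) ζ(r) ζ(rs) ⋯ ζ(rsʰ).  Scaling r in G = 0
-- gives C_0 = 1 - rs C_2 and C_{h+1} = s^⌊h/2⌋ C_h - rs C_{h+3}.  Measure the
-- height of a point (x , y) by h = 2y - x: an up step raises it by 2, and a down
-- step to height h has ⌊h/2⌋ boxes between it and the lowest path.  Splitting off
-- the first step, the area-weighted number of paths with n up steps from height
-- h to 0, times (-s)ⁿ, satisfies the recurrence of the coefficients of rⁿ in C_h.
module Submission where

open import Defs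

open import Algebra.Bundles using (CommutativeMonoid; CommutativeRing; RawRing)
import Algebra.Definitions.RawSemiring as RawSemiringDefs
import Algebra.Morphism.RingMonomorphism as RingMonomorphism
open import Algebra.Morphism.Structures using (IsRingHomomorphism; IsRingMonomorphism)
import Algebra.Properties.AbelianGroup as AbelianGroupProperties
import Algebra.Properties.CommutativeSemigroup as CommutativeSemigroupProperties
import Algebra.Properties.CommutativeSemiring.Exp as Exp
import Algebra.Properties.Group as GroupProperties
import Algebra.Properties.Ring as RingProperties
import Algebra.Solver.Ring.NaturalCoefficients.Default as Solver
open import Data.Integer.Properties using (+-*-commutativeRing)
open import Data.List.Base
  using (List; []; _∷_; _++_; map; foldr; filter; length; applyUpTo; upTo; cartesianProduct)
import Data.List.Properties as List
open import Data.List.Relation.Unary.All as All using (All; []; _∷_)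
import Data.List.Relation.Unary.All.Properties as All
open import Data.Nat.Base as ℕ
  using (ℕ; zero; suc; _∸_; ⌊_/2⌋; _≤_; _<_; z≤n; s≤s)
open import Data.Nat.Induction using (<-rec)
open import Data.Nat.ListAction using (sum)
import Data.Nat.Properties as ℕ
open import Data.Product.Base using (_×_; _,_; proj₁; proj₂)
open import Function.Base using (_∘_; id)
open import Relation.Binary.PropositionalEquality as ≡
  using (_≡_; cong; cong₂; subst; module ≡-Reasoning)
import Relation.Binary.Reasoning.Setoid as ≈-Reasoning
open import Relation.Nullary using (¬_; yes; no; contradiction)
open import Relation.Nullary.Decidable.Core using (_×-dec_)
open import Relation.Unary using (Pred; Decidable)

-- The products C_h come from first passages. Give a path with n up steps the weight (-rs)ⁿ times s
-- to the number of its boxes. Up steps keep the parity of the height, so a path from height 0 to 0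
-- with n up steps has n down steps to even and n to odd heights. Lifting it by k therefore adds kn
-- boxes, whatever the parity of k, and ζ(rsᵏ) should count the paths from height k to k that stay
-- at k or above. A path from h+1 to 0 is such a path at level h+1, then the first down step to h
-- with its ⌊h/2⌋ boxes, then a path from h to 0; this is the passage from C_h to C_{h+1}. The
-- decomposition is only the motivation: the proof compares recurrences, since ζ is known through
-- its equation alone. Setting m = 1 is a ring homomorphism applied coefficientwise. It is carried
-- out before anything else, so that the rest needs just one commutative ring with an element s.

module _ {c ℓ} (R : RawRing c ℓ) where
  open RawRing R
  open RawSemiringDefs rawSemiring using (_^_)

  -- The rescaled series become independent variables here, so that the right side can be moved
  -- along a homomorphism and simplified at m = 1 by ring algebra alone.
  zetaEquationRHS : (r s m z₀ z₁ z₂ z₃ : Carrier) → Carrier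
  zetaEquationRHS r s m z₀ z₁ z₂ z₃ =
      (1# + r * s * (m + - (1# + 1#))) * z₀
    + r * s * z₀ * z₁
    + r * s * (1# + r * s ^ 2 * (m + - 1#)) * z₀ * z₁ * z₂
    + r ^ 2 * s ^ 3 * z₀ * z₁ * z₂ * z₃

module _ {c ℓ} (R : RawRing c ℓ) where
  open RawRing R
  open RawSemiringDefs rawSemiring using (_^_)
  open PowerSeries R renaming (rawRing to seriesRawRing)

  -- Over `ℤ[m,s]`, with its own s and m, this unfolds to `FunctionalEquation`.
  ZetaEquation : (s m : Carrier) → Series → Set ℓ
  ZetaEquation s m ζ = RawRing.1# seriesRawRing ≈ₛ
    zetaEquationRHS seriesRawRing r (const s) (const m)
      ζ (ζ ⟨r· s ^ 1 ⟩) (ζ ⟨r· s ^ 2 ⟩) (ζ ⟨r· s ^ 3 ⟩)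

-- The commutative ring R[[r]] and the substitution of ra for r.

module PowerSeriesProperties {c ℓ} (R : CommutativeRing c ℓ) where
  open CommutativeRing R
  open PowerSeries rawRing renaming (rawRing to seriesRawRing)
  open CommutativeSemigroupProperties
    (CommutativeMonoid.commutativeSemigroup +-commutativeMonoid)
    using (interchange; x∙yz≈y∙xz)
  open Exp commutativeSemiring using (_^_; ^-congˡ; ^-distrib-*)
  open ≈-Reasoning setoid

  infixl 6 _⊕_
  _⊕_ : Series → Series → Series
  _⊕_ = RawRing._+_ seriesRawRing

  -- By computation `(f *ₛ g) (suc n)` is `f 0 * g (suc n) + ((f ∘ suc) *ₛ g) n`. Most laws of the
  -- product below are inductions on the index along this unfolding, with f replaced by its tail.
  *ₛ-cong : ∀ {f f′ g g′} → f ≈ₛ f′ → g ≈ₛ g′ → (f *ₛ g) ≈ₛ (f′ *ₛ g′)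
  *ₛ-cong p q zero    = +-congʳ (*-cong (p 0) (q 0))
  *ₛ-cong p q (suc n) = +-cong (*-cong (p 0) (q (suc n))) (*ₛ-cong (p ∘ suc) q n)

  -- Unfolding peels the left factor only. The induction peels f, swaps, peels g, swaps the two
  -- tails, and reassembles in the other order; it goes down by two, hence the two base cases.
  *ₛ-comm : ∀ f g → (f *ₛ g) ≈ₛ (g *ₛ f)
  *ₛ-comm f g zero          = +-congʳ (*-comm _ _)
  *ₛ-comm f g (suc zero)    = begin
    f 0 * g 1 + (f 1 * g 0 + 0#)  ≈⟨ +-cong (*-comm _ _) (+-congʳ (*-comm _ _)) ⟩
    g 1 * f 0 + (g 0 * f 1 + 0#)  ≈⟨ x∙yz≈y∙xz _ _ _ ⟩
    g 0 * f 1 + (g 1 * f 0 + 0#)  ∎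
  *ₛ-comm f g (suc (suc n)) = begin
    f 0 * g (2+ n) + ((f ∘ suc) *ₛ g) (suc n)
      ≈⟨ +-congˡ (*ₛ-comm (f ∘ suc) g (suc n)) ⟩
    f 0 * g (2+ n) + (g 0 * f (2+ n) + ((g ∘ suc) *ₛ (f ∘ suc)) n)
      ≈⟨ +-cong (*-comm _ _) (+-cong (*-comm _ _) (*ₛ-comm (g ∘ suc) (f ∘ suc) n)) ⟩
    g (2+ n) * f 0 + (f (2+ n) * g 0 + ((f ∘ suc) *ₛ (g ∘ suc)) n)
      ≈⟨ x∙yz≈y∙xz _ _ _ ⟩
    f (2+ n) * g 0 + (g (2+ n) * f 0 + ((f ∘ suc) *ₛ (g ∘ suc)) n)
      ≈⟨ +-cong (*-comm _ _) (+-congʳ (*-comm _ _)) ⟩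
    g 0 * f (2+ n) + (f 0 * g (2+ n) + ((f ∘ suc) *ₛ (g ∘ suc)) n)
      ≈⟨ +-congˡ (*ₛ-comm f (g ∘ suc) (suc n)) ⟩
    g 0 * f (2+ n) + ((g ∘ suc) *ₛ f) (suc n) ∎
    where
    2+ : ℕ → ℕ
    2+ n = suc (suc n)

  *ₛ-distribʳ : ∀ h f g → ((f ⊕ g) *ₛ h) ≈ₛ ((f *ₛ h) ⊕ (g *ₛ h))
  *ₛ-distribʳ h f g zero    = begin
    (f 0 + g 0) * h 0 + 0#              ≈⟨ +-cong (distribʳ _ _ _) (sym (+-identityˡ 0#)) ⟩
    f 0 * h 0 + g 0 * h 0 + (0# + 0#)   ≈⟨ interchange _ _ _ _ ⟩
    f 0 * h 0 + 0# + (g 0 * h 0 + 0#)   ∎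
  *ₛ-distribʳ h f g (suc n) =
    trans (+-cong (distribʳ _ _ _) (*ₛ-distribʳ h (f ∘ suc) (g ∘ suc) n))
          (interchange _ _ _ _)

  scale-*ₛ : ∀ a f g n → ((λ i → a * f i) *ₛ g) n ≈ a * (f *ₛ g) n
  scale-*ₛ a f g zero    = begin
    a * f 0 * g 0 + 0#    ≈⟨ +-identityʳ _ ⟩
    a * f 0 * g 0         ≈⟨ *-assoc _ _ _ ⟩
    a * (f 0 * g 0)       ≈⟨ *-congˡ (+-identityʳ _) ⟨
    a * (f 0 * g 0 + 0#)  ∎
  scale-*ₛ a f g (suc n) =
    trans (+-cong (*-assoc _ _ _) (scale-*ₛ a (f ∘ suc) g n)) (sym (distribˡ _ _ _))

  -- The tail of `f *ₛ g` is by computation `f 0` times the tail of g, plus the tail of f times g;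
  -- distributivity and `scale-*ₛ` then reduce the claim to the tail of f.
  *ₛ-assoc : ∀ f g h → ((f *ₛ g) *ₛ h) ≈ₛ (f *ₛ (g *ₛ h))
  *ₛ-assoc f g h zero    = +-congʳ (begin
    (f 0 * g 0 + 0#) * h 0  ≈⟨ *-congʳ (+-identityʳ _) ⟩
    f 0 * g 0 * h 0         ≈⟨ *-assoc _ _ _ ⟩
    f 0 * (g 0 * h 0)       ≈⟨ *-congˡ (+-identityʳ _) ⟨
    f 0 * (g 0 * h 0 + 0#)  ∎)
  *ₛ-assoc f g h (suc n) = begin
    (f 0 * g 0 + 0#) * h (suc n) + (((λ i → f 0 * g (suc i)) ⊕ ((f ∘ suc) *ₛ g)) *ₛ h) n
      ≈⟨ +-cong (trans (*-congʳ (+-identityʳ _)) (*-assoc _ _ _))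
                (*ₛ-distribʳ h (λ i → f 0 * g (suc i)) ((f ∘ suc) *ₛ g) n) ⟩
    f 0 * (g 0 * h (suc n)) + (((λ i → f 0 * g (suc i)) *ₛ h) n + (((f ∘ suc) *ₛ g) *ₛ h) n)
      ≈⟨ +-congˡ (+-cong (scale-*ₛ (f 0) (g ∘ suc) h n) (*ₛ-assoc (f ∘ suc) g h n)) ⟩
    f 0 * (g 0 * h (suc n)) + (f 0 * ((g ∘ suc) *ₛ h) n + ((f ∘ suc) *ₛ (g *ₛ h)) n)
      ≈⟨ +-assoc _ _ _ ⟨
    f 0 * (g 0 * h (suc n)) + f 0 * ((g ∘ suc) *ₛ h) n + ((f ∘ suc) *ₛ (g *ₛ h)) n
      ≈⟨ +-congʳ (distribˡ _ _ _) ⟨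
    f 0 * (g *ₛ h) (suc n) + ((f ∘ suc) *ₛ (g *ₛ h)) n ∎

  *ₛ-zeroˡ : ∀ f → ((λ _ → 0#) *ₛ f) ≈ₛ (λ _ → 0#)
  *ₛ-zeroˡ f zero    = trans (+-identityʳ _) (zeroˡ _)
  *ₛ-zeroˡ f (suc n) = trans (+-cong (zeroˡ _) (*ₛ-zeroˡ f n)) (+-identityˡ 0#)

  const-*ₛ : ∀ a f n → (const a *ₛ f) n ≈ a * f n
  const-*ₛ a f zero    = +-identityʳ _
  const-*ₛ a f (suc n) = trans (+-congˡ (*ₛ-zeroˡ f n)) (+-identityʳ _)

  *ₛ-identityˡ : ∀ f → (const 1# *ₛ f) ≈ₛ f
  *ₛ-identityˡ f n = trans (const-*ₛ 1# f n) (*-identityˡ _)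

  commutativeRing : CommutativeRing c ℓ
  commutativeRing = record
    { RawRing seriesRawRing
    ; isCommutativeRing = record
      { isRing = record
        { +-isAbelianGroup = record
          { isGroup = record
            { isMonoid = record
              { isSemigroup = record
                { isMagma = record
                  { isEquivalence = record
                    { refl  = λ _ → refl
                    ; sym   = λ p n → sym (p n)
                    ; trans = λ p q n → trans (p n) (q n)
                    }
                  ; ∙-cong = λ p q n → +-cong (p n) (q n)
                  }
                ; assoc = λ f g h n → +-assoc (f n) (g n) (h n)
                }
              ; identity = (λ f n → +-identityˡ (f n)) , (λ f n → +-identityʳ (f n))
              }
            ; inverse = (λ f n → -‿inverseˡ (f n)) , (λ f n → -‿inverseʳ (f n))
            ; ⁻¹-cong = λ p n → -‿cong (p n)
            }
          ; comm = λ f g n → +-comm (f n) (g n)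
          }
        ; *-cong = *ₛ-cong
        ; *-assoc = *ₛ-assoc
        ; *-identity = *ₛ-identityˡ ,
            (λ f n → trans (*ₛ-comm f (const 1#) n) (*ₛ-identityˡ f n))
        ; distrib =
            (λ h f g n → trans (*ₛ-comm h (f ⊕ g) n) (trans (*ₛ-distribʳ h f g n)
               (+-cong (*ₛ-comm f h n) (*ₛ-comm g h n))))
            , *ₛ-distribʳ
        }
      ; *-comm = *ₛ-comm
      }
    }

  r-*ₛ-zero : ∀ f → (r *ₛ f) 0 ≈ 0#
  r-*ₛ-zero f = trans (+-identityʳ _) (zeroˡ _)

  r-*ₛ-suc : ∀ f n → (r *ₛ f) (suc n) ≈ f n
  r-*ₛ-suc f n = begin
    0# * f (suc n) + ((r ∘ suc) *ₛ f) n  ≈⟨ trans (+-congʳ (zeroˡ _)) (+-identityˡ _) ⟩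
    ((r ∘ suc) *ₛ f) n                   ≈⟨ *ₛ-cong {g = f} r∘suc (λ _ → refl) n ⟩
    (const 1# *ₛ f) n                    ≈⟨ *ₛ-identityˡ f n ⟩
    f n                                  ∎
    where
    r∘suc : (r ∘ suc) ≈ₛ const 1#
    r∘suc zero    = refl
    r∘suc (suc n) = refl

  -- The tail of `f ⟨r· a ⟩` is a times the rescaled tail of f, so each step of the induction has to
  -- carry one factor a through the product.
  *ₛ-⟨r·⟩ : ∀ a f g → ((f *ₛ g) ⟨r· a ⟩) ≈ₛ ((f ⟨r· a ⟩) *ₛ (g ⟨r· a ⟩))
  *ₛ-⟨r·⟩ a f g zero    =
    trans (*-identityʳ _) (+-congʳ (sym (*-cong (*-identityʳ _) (*-identityʳ _))))
  *ₛ-⟨r·⟩ a f g (suc n) = begin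
    (f 0 * g (suc n) + ((f ∘ suc) *ₛ g) n) * a ^ suc n
      ≈⟨ distribʳ _ _ _ ⟩
    f 0 * g (suc n) * a ^ suc n + ((f ∘ suc) *ₛ g) n * (a * a ^ n)
      ≈⟨ +-cong (trans (*-assoc _ _ _) (*-congʳ (sym (*-identityʳ _)))) (x*[a*b]≈a*[x*b] _ _ _) ⟩
    f 0 * 1# * (g (suc n) * a ^ suc n) + a * (((f ∘ suc) *ₛ g) n * a ^ n)
      ≈⟨ +-congˡ (*-congˡ (*ₛ-⟨r·⟩ a (f ∘ suc) g n)) ⟩
    f 0 * 1# * (g (suc n) * a ^ suc n) + a * (((f ∘ suc) ⟨r· a ⟩) *ₛ (g ⟨r· a ⟩)) n
      ≈⟨ +-congˡ (scale-*ₛ a ((f ∘ suc) ⟨r· a ⟩) (g ⟨r· a ⟩) n) ⟨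
    f 0 * 1# * (g (suc n) * a ^ suc n) + ((λ i → a * (f (suc i) * a ^ i)) *ₛ (g ⟨r· a ⟩)) n
      ≈⟨ +-congˡ (*ₛ-cong {g = g ⟨r· a ⟩}
           (λ i → x*[a*b]≈a*[x*b] (f (suc i)) a (a ^ i)) (λ _ → refl) n) ⟨
    f 0 * 1# * (g (suc n) * a ^ suc n) + (((f ⟨r· a ⟩) ∘ suc) *ₛ (g ⟨r· a ⟩)) n ∎
    where
    x*[a*b]≈a*[x*b] : ∀ x a b → x * (a * b) ≈ a * (x * b)
    x*[a*b]≈a*[x*b] x a b =
      trans (sym (*-assoc x a b)) (trans (*-congʳ (*-comm x a)) (*-assoc a x b))

  const-⟨r·⟩ : ∀ a b → (const b ⟨r· a ⟩) ≈ₛ const b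
  const-⟨r·⟩ a b zero    = *-identityʳ b
  const-⟨r·⟩ a b (suc n) = zeroˡ _

  r-⟨r·⟩ : ∀ a → (r ⟨r· a ⟩) ≈ₛ (const a *ₛ r)
  r-⟨r·⟩ a n = trans (coefficient n) (sym (const-*ₛ a r n))
    where
    coefficient : ∀ n → (r ⟨r· a ⟩) n ≈ a * r n
    coefficient 0             = trans (zeroˡ _) (sym (zeroʳ _))
    coefficient 1             = *-identityˡ _
    coefficient (suc (suc n)) = trans (zeroˡ _) (sym (zeroʳ _))

  ⟨r·⟩-⟨r·⟩ : ∀ a b f → ((f ⟨r· a ⟩) ⟨r· b ⟩) ≈ₛ (f ⟨r· a * b ⟩)
  ⟨r·⟩-⟨r·⟩ a b f n = trans (*-assoc _ _ _) (*-congˡ (sym (^-distrib-* a b n)))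

  ⟨r·⟩-congʳ : ∀ f {a b} → a ≈ b → (f ⟨r· a ⟩) ≈ₛ (f ⟨r· b ⟩)
  ⟨r·⟩-congʳ f a≈b n = *-congˡ (^-congˡ n a≈b)

  const-cong : ∀ {a b} → a ≈ b → const a ≈ₛ const b
  const-cong p zero    = p
  const-cong p (suc n) = refl

  const-*-const : ∀ a b → (const a *ₛ const b) ≈ₛ const (a * b)
  const-*-const a b n = trans (const-*ₛ a (const b) n) (scale n)
    where
    scale : ∀ n → a * const b n ≈ const (a * b) n
    scale zero    = refl
    scale (suc n) = zeroʳ a

  -- Coefficient n of a product sees g only up to index n; the strong induction in `defect≈0`
  -- depends on this.
  *ₛ-vanishʳ : ∀ f g n → (∀ {i} → i ≤ n → g i ≈ 0#) → (f *ₛ g) n ≈ 0#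
  *ₛ-vanishʳ f g zero    g≈0 = trans (+-identityʳ _) (trans (*-congˡ (g≈0 z≤n)) (zeroʳ _))
  *ₛ-vanishʳ f g (suc n) g≈0 =
    trans (+-cong (trans (*-congˡ (g≈0 ℕ.≤-refl)) (zeroʳ _))
                  (*ₛ-vanishʳ (f ∘ suc) g n (g≈0 ∘ ℕ.m≤n⇒m≤1+n)))
          (+-identityˡ _)

-- The polynomial ring and evaluation at a point.

module PolynomialProperties {c ℓ} (R : CommutativeRing c ℓ) where
  open CommutativeRing R
  open Polynomial rawRing renaming (rawRing to polyRawRing)
  open PowerSeries rawRing using (_*ₛ_; _≈ₛ_) renaming (rawRing to seriesRawRing)
  private
    module S = PowerSeriesProperties R
  open GroupProperties +-group using (ε⁻¹≈ε)

  coeff-+ₚ : ∀ p q i → coeff (p +ₚ q) i ≈ coeff p i + coeff q i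
  coeff-+ₚ []      q       i       = sym (+-identityˡ _)
  coeff-+ₚ (a ∷ p) []      i       = sym (+-identityʳ _)
  coeff-+ₚ (a ∷ p) (b ∷ q) zero    = refl
  coeff-+ₚ (a ∷ p) (b ∷ q) (suc i) = coeff-+ₚ p q i

  coeff-map-* : ∀ a p i → coeff (map (a *_) p) i ≈ a * coeff p i
  coeff-map-* a []      i       = sym (zeroʳ a)
  coeff-map-* a (b ∷ p) zero    = refl
  coeff-map-* a (b ∷ p) (suc i) = coeff-map-* a p i

  coeff-map‿- : ∀ p i → coeff (map (-_) p) i ≈ - coeff p i
  coeff-map‿- []      i       = sym ε⁻¹≈ε
  coeff-map‿- (b ∷ p) zero    = refl
  coeff-map‿- (b ∷ p) (suc i) = coeff-map‿- p i

  coeff-*ₚ : ∀ p q → coeff (p *ₚ q) ≈ₛ (coeff p *ₛ coeff q)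
  coeff-*ₚ []      q i       = sym (S.*ₛ-zeroˡ (coeff q) i)
  coeff-*ₚ (a ∷ p) q zero    =
    trans (coeff-+ₚ (map (a *_) q) _ 0) (+-congʳ (coeff-map-* a q 0))
  coeff-*ₚ (a ∷ p) q (suc i) =
    trans (coeff-+ₚ (map (a *_) q) _ (suc i))
          (+-cong (coeff-map-* a q (suc i)) (coeff-*ₚ p q i))

  coeff-1# : ∀ i → coeff (const 1#) i ≈ PowerSeries.const rawRing 1# i
  coeff-1# zero    = refl
  coeff-1# (suc i) = refl

  -- Polynomials are compared by their coefficient sequences, so injectivity is immediate and all
  -- ring laws can be pulled back from series.
  coeff-isRingMonomorphism : IsRingMonomorphism polyRawRing seriesRawRing coeff
  coeff-isRingMonomorphism = record
    { isRingHomomorphism = record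
      { isSemiringHomomorphism = record
        { isNearSemiringHomomorphism = record
          { +-isMonoidHomomorphism = record
            { isMagmaHomomorphism = record
              { isRelHomomorphism = record { cong = λ p → p }
              ; homo = coeff-+ₚ
              }
            ; ε-homo = λ _ → refl
            }
          ; *-homo = coeff-*ₚ
          }
        ; 1#-homo = coeff-1#
        }
      ; -‿homo = coeff-map‿-
      }
    ; injective = λ p → p
    }

  commutativeRing : CommutativeRing c ℓ
  commutativeRing = record
    { RawRing polyRawRing
    ; isCommutativeRing = RingMonomorphism.isCommutativeRing coeff-isRingMonomorphism
        (CommutativeRing.isCommutativeRing S.commutativeRing)
    }

  module Evaluation (x : Carrier) where
    open ≈-Reasoning setoid
    open CommutativeSemigroupProperties
      (CommutativeMonoid.commutativeSemigroup +-commutativeMonoid)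
      using (interchange)

    -- Equal polynomials may differ by trailing zeros; this handles the surplus when `eval-cong`
    -- compares lists of different lengths.
    eval-≈0 : ∀ p → p ≈ₚ [] → eval x p ≈ 0#
    eval-≈0 []      _ = refl
    eval-≈0 (a ∷ p) e = begin
      a + x * eval x p  ≈⟨ +-cong (e 0) (*-congˡ (eval-≈0 p (e ∘ suc))) ⟩
      0# + x * 0#       ≈⟨ trans (+-identityˡ _) (zeroʳ x) ⟩
      0#                ∎

    eval-cong : ∀ {p q} → p ≈ₚ q → eval x p ≈ eval x q
    eval-cong {[]}    {q}     e = sym (eval-≈0 q (sym ∘ e))
    eval-cong {a ∷ p} {[]}    e = eval-≈0 (a ∷ p) e
    eval-cong {a ∷ p} {b ∷ q} e = +-cong (e 0) (*-congˡ (eval-cong {p} {q} (e ∘ suc)))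

    eval-+ₚ : ∀ p q → eval x (p +ₚ q) ≈ eval x p + eval x q
    eval-+ₚ []      q       = sym (+-identityˡ _)
    eval-+ₚ (a ∷ p) []      = sym (+-identityʳ _)
    eval-+ₚ (a ∷ p) (b ∷ q) = begin
      a + b + x * eval x (p +ₚ q)               ≈⟨ +-congˡ (*-congˡ (eval-+ₚ p q)) ⟩
      a + b + x * (eval x p + eval x q)         ≈⟨ +-congˡ (distribˡ _ _ _) ⟩
      a + b + (x * eval x p + x * eval x q)     ≈⟨ interchange _ _ _ _ ⟩
      a + x * eval x p + (b + x * eval x q)     ∎

    eval-map-* : ∀ a p → eval x (map (a *_) p) ≈ a * eval x p
    eval-map-* a []      = sym (zeroʳ a)
    eval-map-* a (b ∷ p) = begin
      a * b + x * eval x (map (a *_) p)  ≈⟨ +-congˡ (*-congˡ (eval-map-* a p)) ⟩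
      a * b + x * (a * eval x p)         ≈⟨ +-congˡ (sym (*-assoc _ _ _)) ⟩
      a * b + x * a * eval x p           ≈⟨ +-congˡ (*-congʳ (*-comm x a)) ⟩
      a * b + a * x * eval x p           ≈⟨ +-congˡ (*-assoc _ _ _) ⟩
      a * b + a * (x * eval x p)         ≈⟨ distribˡ _ _ _ ⟨
      a * (b + x * eval x p)             ∎

    eval-map‿- : ∀ p → eval x (map (-_) p) ≈ - eval x p
    eval-map‿- p = uniqueˡ-⁻¹ _ _ (begin
      eval x (map (-_) p) + eval x p  ≈⟨ eval-+ₚ (map (-_) p) p ⟨
      eval x (map (-_) p +ₚ p)        ≈⟨ eval-≈0 (map (-_) p +ₚ p) (-ₚ‿inverseˡ p) ⟩
      0#                              ∎)
      where open CommutativeRing commutativeRing using () renaming (-‿inverseˡ to -ₚ‿inverseˡ)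

    eval-*ₚ : ∀ p q → eval x (p *ₚ q) ≈ eval x p * eval x q
    eval-*ₚ []      q = sym (zeroˡ _)
    eval-*ₚ (a ∷ p) q = begin
      eval x (map (a *_) q +ₚ (0# ∷ (p *ₚ q)))
        ≈⟨ eval-+ₚ (map (a *_) q) _ ⟩
      eval x (map (a *_) q) + (0# + x * eval x (p *ₚ q))
        ≈⟨ +-cong (eval-map-* a q) (trans (+-identityˡ _) (*-congˡ (eval-*ₚ p q))) ⟩
      a * eval x q + x * (eval x p * eval x q)
        ≈⟨ +-congˡ (*-assoc _ _ _) ⟨
      a * eval x q + x * eval x p * eval x q
        ≈⟨ distribʳ _ _ _ ⟨
      (a + x * eval x p) * eval x q ∎

    eval-const : ∀ a → eval x (const a) ≈ a
    eval-const a = trans (+-congˡ (zeroʳ x)) (+-identityʳ a)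

    eval-X : eval x X ≈ x
    eval-X = trans (+-identityˡ _) (trans (*-congˡ (eval-const 1#)) (*-identityʳ x))

    eval-isRingHomomorphism : IsRingHomomorphism polyRawRing rawRing (eval x)
    eval-isRingHomomorphism = record
      { isSemiringHomomorphism = record
        { isNearSemiringHomomorphism = record
          { +-isMonoidHomomorphism = record
            { isMagmaHomomorphism = record
              { isRelHomomorphism = record { cong = λ {p} {q} → eval-cong {p} {q} }
              ; homo = eval-+ₚ
              }
            ; ε-homo = refl
            }
          ; *-homo = eval-*ₚ
          }
        ; 1#-homo = eval-const 1#
        }
      ; -‿homo = eval-map‿-
      }

-- Transport of the functional equation along a homomorphism of coefficients.

module RingHomomorphismProperties {a ℓ₁ b ℓ₂} {A : RawRing a ℓ₁} (B : CommutativeRing b ℓ₂)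
  {φ : RawRing.Carrier A → CommutativeRing.Carrier B}
  (φ-isRingHomomorphism : IsRingHomomorphism A (CommutativeRing.rawRing B) φ) where
  open CommutativeRing B
  open IsRingHomomorphism φ-isRingHomomorphism hiding (+-isMagmaHomomorphism)
  private
    module A = RawRing A
    module A^ = RawSemiringDefs A.rawSemiring
    module A⟦r⟧ = PowerSeries A
    module B⟦r⟧ = PowerSeries rawRing
  open PowerSeriesProperties B using (const-cong)
  open Exp commutativeSemiring using (_^_; ^-congˡ)

  ^-homo : ∀ x n → φ (x A^.^ n) ≈ φ x ^ n
  ^-homo x zero    = 1#-homo
  ^-homo x (suc n) = trans (*-homo _ _) (*-congˡ (^-homo x n))

  *ₛ-homo : ∀ f g → (φ ∘ (f A⟦r⟧.*ₛ g)) B⟦r⟧.≈ₛ ((φ ∘ f) B⟦r⟧.*ₛ (φ ∘ g))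
  *ₛ-homo f g zero    = trans (+-homo _ _) (+-cong (*-homo _ _) 0#-homo)
  *ₛ-homo f g (suc n) = trans (+-homo _ _) (+-cong (*-homo _ _) (*ₛ-homo (f ∘ suc) g n))

  const-homo : ∀ x → (φ ∘ A⟦r⟧.const x) B⟦r⟧.≈ₛ B⟦r⟧.const (φ x)
  const-homo x zero    = refl
  const-homo x (suc n) = 0#-homo

  r-homo : (φ ∘ A⟦r⟧.r) B⟦r⟧.≈ₛ B⟦r⟧.r
  r-homo 0             = 0#-homo
  r-homo 1             = 1#-homo
  r-homo (suc (suc n)) = 0#-homo

  ⟨r·⟩-homo : ∀ x f → (φ ∘ (f A⟦r⟧.⟨r· x ⟩)) B⟦r⟧.≈ₛ ((φ ∘ f) B⟦r⟧.⟨r· φ x ⟩)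
  ⟨r·⟩-homo x f n = trans (*-homo _ _) (*-congˡ (^-homo x n))

  ∘-isRingHomomorphism : IsRingHomomorphism A⟦r⟧.rawRing B⟦r⟧.rawRing (φ ∘_)
  ∘-isRingHomomorphism = record
    { isSemiringHomomorphism = record
      { isNearSemiringHomomorphism = record
        { +-isMonoidHomomorphism = record
          { isMagmaHomomorphism = record
            { isRelHomomorphism = record { cong = λ p n → ⟦⟧-cong (p n) }
            ; homo = λ f g n → +-homo (f n) (g n)
            }
          ; ε-homo = λ _ → 0#-homo
          }
        ; *-homo = *ₛ-homo
        }
      ; 1#-homo = λ n → trans (const-homo A.1# n) (const-cong 1#-homo n)
      }
    ; -‿homo = λ f n → -‿homo (f n)
    }

  -- The images are given only up to equality, so constants and rescaled series are rewritten in the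
  -- same pass. The proof term repeats the formula with operators that act on these equalities.
  zetaEquationRHS-homo : ∀ {r s m z₀ z₁ z₂ z₃ r′ s′ m′ z₀′ z₁′ z₂′ z₃′} →
    φ r ≈ r′ → φ s ≈ s′ → φ m ≈ m′ → φ z₀ ≈ z₀′ → φ z₁ ≈ z₁′ → φ z₂ ≈ z₂′ → φ z₃ ≈ z₃′ →
    φ (zetaEquationRHS A r s m z₀ z₁ z₂ z₃) ≈
      zetaEquationRHS rawRing r′ s′ m′ z₀′ z₁′ z₂′ z₃′
  zetaEquationRHS-homo r s m z₀ z₁ z₂ z₃ =
    ((one ⊕ r ⊛ s ⊛ (m ⊕ neg (one ⊕ one))) ⊛ z₀)
    ⊕ (r ⊛ s ⊛ z₀ ⊛ z₁)
    ⊕ (r ⊛ s ⊛ (one ⊕ r ⊛ s ^′ 2 ⊛ (m ⊕ neg one)) ⊛ z₀ ⊛ z₁ ⊛ z₂)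
    ⊕ (r ^′ 2 ⊛ s ^′ 3 ⊛ z₀ ⊛ z₁ ⊛ z₂ ⊛ z₃)
    where
    infixl 6 _⊕_
    infixl 7 _⊛_
    infixr 8 _^′_

    one : φ A.1# ≈ 1#
    one = 1#-homo

    _⊕_ : ∀ {x y x′ y′} → φ x ≈ x′ → φ y ≈ y′ → φ (x A.+ y) ≈ x′ + y′
    p ⊕ q = trans (+-homo _ _) (+-cong p q)

    _⊛_ : ∀ {x y x′ y′} → φ x ≈ x′ → φ y ≈ y′ → φ (x A.* y) ≈ x′ * y′
    p ⊛ q = trans (*-homo _ _) (*-cong p q)

    neg : ∀ {x x′} → φ x ≈ x′ → φ (A.- x) ≈ - x′
    neg p = trans (-‿homo _) (-‿cong p)

    _^′_ : ∀ {x x′} → φ x ≈ x′ → ∀ n → φ (x A^.^ n) ≈ x′ ^ n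
    p ^′ n = trans (^-homo _ n) (^-congˡ n p)

module _ {a ℓ₁ b ℓ₂} {A : RawRing a ℓ₁} (B : CommutativeRing b ℓ₂)
  {φ : RawRing.Carrier A → CommutativeRing.Carrier B}
  (φ-isRingHomomorphism : IsRingHomomorphism A (CommutativeRing.rawRing B) φ) where
  open CommutativeRing B
  open RingHomomorphismProperties B φ-isRingHomomorphism
  private
    module Φ = IsRingHomomorphism ∘-isRingHomomorphism
    module A = RawRing A
    module A^ = RawSemiringDefs A.rawSemiring
    module A⟦r⟧ = PowerSeries A
    module B⟦r⟧ = PowerSeries rawRing
  open PowerSeriesProperties B using (const-cong; ⟨r·⟩-congʳ)
  open Exp commutativeSemiring using (_^_; ^-congˡ)

  -- The equation lives in series, so the homomorphism to use is `φ ∘_`, one level above φ; it fixes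
  -- r and turns scaling by `s ^ k` into scaling by `s′ ^ k`.
  zetaEquation-homo : ∀ s m ζ {s′ m′} → φ s ≈ s′ → φ m ≈ m′ →
    ZetaEquation A s m ζ → ZetaEquation rawRing s′ m′ (φ ∘ ζ)
  zetaEquation-homo s m ζ {s′} s≈ m≈ equation n =
    trans (sym (Φ.1#-homo n)) (trans (Φ.⟦⟧-cong equation n)
      (RingHomomorphismProperties.zetaEquationRHS-homo
        (PowerSeriesProperties.commutativeRing B) ∘-isRingHomomorphism {z₀ = ζ}
        r-homo (const≈ s s≈) (const≈ m m≈) (λ _ → refl) (scale≈ 1) (scale≈ 2) (scale≈ 3) n))
    where
    const≈ : ∀ x {y} → φ x ≈ y → (φ ∘ A⟦r⟧.const x) B⟦r⟧.≈ₛ B⟦r⟧.const y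
    const≈ x p n = trans (const-homo x n) (const-cong p n)

    scale≈ : ∀ k → (φ ∘ (ζ A⟦r⟧.⟨r· s A^.^ k ⟩)) B⟦r⟧.≈ₛ ((φ ∘ ζ) B⟦r⟧.⟨r· s′ ^ k ⟩)
    scale≈ k n = trans (⟨r·⟩-homo (s A^.^ k) ζ n)
      (⟨r·⟩-congʳ (φ ∘ ζ) (trans (^-homo s k) (^-congˡ k s≈)) n)

-- The equation at m = 1 and the recurrences for the products C_h.

module ZetaAtOne {c ℓ} (R : CommutativeRing c ℓ) where
  open CommutativeRing R
  open Solver commutativeSemiring
  open ≈-Reasoning setoid
  open Exp commutativeSemiring using (_^_)

  residual : ∀ r s z₀ z₁ z₂ z₃ →
    1# ≈ zetaEquationRHS rawRing r s 1# z₀ z₁ z₂ z₃ →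
    (z₀ + r * s * z₀ * z₁ * z₂ + - 1#)
      + r * s * z₀ * (z₁ + r * s * s * z₁ * z₂ * z₃ + - 1#) ≈ 0#
  residual r s z₀ z₁ z₂ z₃ eq = begin
    (z₀ + r * s * z₀ * z₁ * z₂ + - 1#)
      + r * s * z₀ * (z₁ + r * s * s * z₁ * z₂ * z₃ + - 1#)
      ≈⟨ rearrange r s (- 1#) z₀ z₁ z₂ z₃ ⟩
    - 1# + ((1# + r * s * - 1#) * z₀ + r * s * z₀ * z₁ + r * s * 1# * z₀ * z₁ * z₂
      + r ^ 2 * s ^ 3 * z₀ * z₁ * z₂ * z₃)
      ≈⟨ +-congˡ (+-congʳ (+-cong (+-congʳ (*-congʳ (+-congˡ (*-congˡ 1-2≈-1))))
                                  (*-congʳ (*-congʳ (*-congʳ (*-congˡ 1+a[1-1]≈1)))))) ⟨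
    - 1# + zetaEquationRHS rawRing r s 1# z₀ z₁ z₂ z₃
      ≈⟨ +-congˡ eq ⟨
    - 1# + 1#
      ≈⟨ -‿inverseˡ 1# ⟩
    0# ∎
    where
    -- The solver has only natural coefficients, so - 1# becomes a variable e.
    rearrange : ∀ r s e z₀ z₁ z₂ z₃ →
      (z₀ + r * s * z₀ * z₁ * z₂ + e) + r * s * z₀ * (z₁ + r * s * s * z₁ * z₂ * z₃ + e)
      ≈ e + ((1# + r * s * e) * z₀ + r * s * z₀ * z₁ + r * s * 1# * z₀ * z₁ * z₂
             + r ^ 2 * s ^ 3 * z₀ * z₁ * z₂ * z₃)
    rearrange = solve 7 (λ r s e z₀ z₁ z₂ z₃ →
      (z₀ :+ r :* s :* z₀ :* z₁ :* z₂ :+ e)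
        :+ r :* s :* z₀ :* (z₁ :+ r :* s :* s :* z₁ :* z₂ :* z₃ :+ e)
      := e :+ ((con 1 :+ r :* s :* e) :* z₀ :+ r :* s :* z₀ :* z₁
               :+ r :* s :* con 1 :* z₀ :* z₁ :* z₂
               :+ r :^ 2 :* s :^ 3 :* z₀ :* z₁ :* z₂ :* z₃)) refl

    1-2≈-1 : 1# + - (1# + 1#) ≈ - 1#
    1-2≈-1 = begin
      1# + - (1# + 1#)      ≈⟨ +-congˡ (AbelianGroupProperties.⁻¹-∙-comm +-abelianGroup 1# 1#) ⟨
      1# + (- 1# + - 1#)    ≈⟨ +-assoc _ _ _ ⟨
      1# + - 1# + - 1#      ≈⟨ +-congʳ (-‿inverseʳ 1#) ⟩
      0# + - 1#             ≈⟨ +-identityˡ _ ⟩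
      - 1#                  ∎

    1+a[1-1]≈1 : ∀ {a} → 1# + a * (1# + - 1#) ≈ 1#
    1+a[1-1]≈1 = trans (+-congˡ (trans (*-congˡ (-‿inverseʳ 1#)) (zeroʳ _))) (+-identityʳ 1#)

module ZetaSeries {c ℓ} (R : CommutativeRing c ℓ) (s : CommutativeRing.Carrier R)
  (z : PowerSeries.Series (CommutativeRing.rawRing R)) where
  private
    module R = CommutativeRing R
    open PowerSeries R.rawRing using (Series; const; r; _⟨r·_⟩)
    module P = PowerSeriesProperties R
    open CommutativeRing P.commutativeRing
    open Exp R.commutativeSemiring using (_^_; ^-congʳ; ^-homo-*)
    open ≈-Reasoning setoid
    module R-Reasoning = ≈-Reasoning R.setoid

    S : Series
    S = const s

  ζ⟨rs^_⟩ : ℕ → Series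
  ζ⟨rs^ k ⟩ = z ⟨r· s ^ k ⟩

  ζ-shift : ∀ k j → (ζ⟨rs^ k ⟩ ⟨r· s ^ j ⟩) ≈ ζ⟨rs^ k ℕ.+ j ⟩
  ζ-shift k j n = R.trans (P.⟨r·⟩-⟨r·⟩ (s ^ k) (s ^ j) z n)
                          (P.⟨r·⟩-congʳ z (R.sym (^-homo-* s k j)) n)

  ζ⟨rs^0⟩ : ζ⟨rs^ 0 ⟩ ≈ z
  ζ⟨rs^0⟩ n = R.trans (R.*-congˡ (1^n n)) (R.*-identityʳ _)
    where
    1^n : ∀ n → R.1# ^ n R.≈ R.1#
    1^n zero    = R.refl
    1^n (suc n) = R.trans (R.*-identityˡ _) (1^n n)

  triple : ℕ → Series
  triple h = ζ⟨rs^ h ⟩ * ζ⟨rs^ 1 ℕ.+ h ⟩ * ζ⟨rs^ 2 ℕ.+ h ⟩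

  triple-shift : ∀ h → (triple 0 ⟨r· s ^ h ⟩) ≈ triple h
  triple-shift h = begin
    triple 0 ⟨r· s ^ h ⟩
      ≈⟨ P.*ₛ-⟨r·⟩ (s ^ h) (ζ⟨rs^ 0 ⟩ * ζ⟨rs^ 1 ⟩) ζ⟨rs^ 2 ⟩ ⟩
    ((ζ⟨rs^ 0 ⟩ * ζ⟨rs^ 1 ⟩) ⟨r· s ^ h ⟩) * (ζ⟨rs^ 2 ⟩ ⟨r· s ^ h ⟩)
      ≈⟨ *-cong (P.*ₛ-⟨r·⟩ (s ^ h) ζ⟨rs^ 0 ⟩ ζ⟨rs^ 1 ⟩) (ζ-shift 2 h) ⟩
    (ζ⟨rs^ 0 ⟩ ⟨r· s ^ h ⟩) * (ζ⟨rs^ 1 ⟩ ⟨r· s ^ h ⟩) * ζ⟨rs^ 2 ℕ.+ h ⟩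
      ≈⟨ *-congʳ {ζ⟨rs^ 2 ℕ.+ h ⟩} (*-cong (ζ-shift 0 h) (ζ-shift 1 h)) ⟩
    triple h ∎

  -- This is G(rsʰ): the factor rs of G becomes rsʰ⁺¹.
  defect : ℕ → Series
  defect h = ζ⟨rs^ h ⟩ + r * const (s ^ suc h) * triple h + - 1#

  defect-shift : ∀ h → (defect 0 ⟨r· s ^ h ⟩) ≈ defect h
  defect-shift h n = R-Reasoning.begin
    ((ζ⟨rs^ 0 ⟩ n R.+ (r * const (s ^ 1) * triple 0) n) R.+ (- 1#) n) R.* (s ^ h) ^ n
      R-Reasoning.≈⟨ R.trans (R.distribʳ _ _ _) (R.+-congʳ (R.distribʳ _ _ _)) ⟩
    (ζ⟨rs^ 0 ⟩ ⟨r· s ^ h ⟩) n R.+ ((r * const (s ^ 1) * triple 0) ⟨r· s ^ h ⟩) n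
      R.+ ((- 1#) ⟨r· s ^ h ⟩) n
      R-Reasoning.≈⟨ R.+-cong (R.+-cong (ζ-shift 0 h n) (middle n)) last ⟩
    defect h n R-Reasoning.∎
    where
    middle : ((r * const (s ^ 1) * triple 0) ⟨r· s ^ h ⟩) ≈ r * const (s ^ suc h) * triple h
    middle = begin
      (r * const (s ^ 1) * triple 0) ⟨r· s ^ h ⟩
        ≈⟨ P.*ₛ-⟨r·⟩ (s ^ h) (r * const (s ^ 1)) (triple 0) ⟩
      ((r * const (s ^ 1)) ⟨r· s ^ h ⟩) * (triple 0 ⟨r· s ^ h ⟩)
        ≈⟨ *-cong (P.*ₛ-⟨r·⟩ (s ^ h) r (const (s ^ 1))) (triple-shift h) ⟩
      (r ⟨r· s ^ h ⟩) * (const (s ^ 1) ⟨r· s ^ h ⟩) * triple h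
        ≈⟨ *-congʳ {triple h} (*-cong (P.r-⟨r·⟩ (s ^ h)) (P.const-⟨r·⟩ (s ^ h) (s ^ 1))) ⟩
      const (s ^ h) * r * const (s ^ 1) * triple h
        ≈⟨ *-congʳ {triple h} (trans (*-congʳ {const (s ^ 1)} (*-comm (const (s ^ h)) r))
                                     (*-assoc r (const (s ^ h)) (const (s ^ 1)))) ⟩
      r * (const (s ^ h) * const (s ^ 1)) * triple h
        ≈⟨ *-congʳ {triple h} (*-congˡ {r} (trans (P.const-*-const (s ^ h) (s ^ 1))
              (P.const-cong (R.trans (R.*-comm _ _) (R.*-congʳ (R.*-identityʳ s)))))) ⟩
      r * const (s ^ suc h) * triple h ∎

    last : ((- 1#) ⟨r· s ^ h ⟩) n R.≈ (- 1#) n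
    last = R.trans (R.sym (RingProperties.-‿distribˡ-* R.ring _ _))
                   (R.-‿cong (P.const-⟨r·⟩ (s ^ h) R.1# n))

  -- This is C_h, built one level at a time: the new factors stand for the down step from h+1 to h
  -- and for the part of the path before it.
  descents : ℕ → Series
  descents zero    = ζ⟨rs^ 0 ⟩
  descents (suc h) = const (s ^ ⌊ h /2⌋) * descents h * ζ⟨rs^ suc h ⟩

  module _ (equation : ZetaEquation R.rawRing s R.1# z) where

    -- The factor r is kept outermost because multiplication by it shifts coefficients by one; the
    -- second summand at index n then involves `defect 1` only below n.
    defect-recurrence : defect 0 + r * (S * z * defect 1) ≈ 0#
    defect-recurrence = begin
      defect 0 + r * (S * z * defect 1)
        ≈⟨ +-cong (+-congʳ { - 1# } (+-cong ζ⟨rs^0⟩ front))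
                  (trans (sym (*-assoc r (S * z) (defect 1)))
                         (*-cong (sym (*-assoc r S z))
                                 (+-congʳ { - 1# } (+-congˡ {ζ⟨rs^ 1 ⟩} back)))) ⟩
      (z + r * S * z * ζ⟨rs^ 1 ⟩ * ζ⟨rs^ 2 ⟩ + - 1#)
        + r * S * z * (ζ⟨rs^ 1 ⟩ + r * S * S * ζ⟨rs^ 1 ⟩ * ζ⟨rs^ 2 ⟩ * ζ⟨rs^ 3 ⟩ + - 1#)
        ≈⟨ ZetaAtOne.residual P.commutativeRing r S z ζ⟨rs^ 1 ⟩ ζ⟨rs^ 2 ⟩ ζ⟨rs^ 3 ⟩ equation ⟩
      0# ∎
      where
      reassoc : ∀ a b c d → a * (b * c * d) ≈ a * b * c * d
      reassoc a b c d = trans (sym (*-assoc a (b * c) d)) (*-congʳ {d} (sym (*-assoc a b c)))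

      front : r * const (s ^ 1) * triple 0 ≈ r * S * z * ζ⟨rs^ 1 ⟩ * ζ⟨rs^ 2 ⟩
      front = trans (*-cong (*-congˡ {r} (P.const-cong (R.*-identityʳ s)))
                            (*-congʳ {ζ⟨rs^ 2 ⟩} (*-congʳ {ζ⟨rs^ 1 ⟩} ζ⟨rs^0⟩)))
                    (reassoc (r * S) z ζ⟨rs^ 1 ⟩ ζ⟨rs^ 2 ⟩)

      back : r * const (s ^ 2) * triple 1 ≈ r * S * S * ζ⟨rs^ 1 ⟩ * ζ⟨rs^ 2 ⟩ * ζ⟨rs^ 3 ⟩
      back = trans (*-congʳ {triple 1} (trans (*-congˡ {r} s²≈S*S) (sym (*-assoc r S S))))
                   (reassoc (r * S * S) ζ⟨rs^ 1 ⟩ ζ⟨rs^ 2 ⟩ ζ⟨rs^ 3 ⟩)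
        where
        s²≈S*S : const (s ^ 2) ≈ S * S
        s²≈S*S = trans (P.const-cong (R.*-congˡ (R.*-identityʳ s))) (sym (P.const-*-const s s))

    defect≈0 : defect 0 ≈ 0#
    defect≈0 = <-rec (λ n → defect 0 n R.≈ R.0#) step
      where
      tail : ∀ n → (∀ {i} → i < n → defect 0 i R.≈ R.0#) →
        (r * (S * z * defect 1)) n R.≈ R.0#
      tail zero    ih = P.r-*ₛ-zero (S * z * defect 1)
      tail (suc n) ih = R.trans (P.r-*ₛ-suc (S * z * defect 1) n)
        (P.*ₛ-vanishʳ (S * z) (defect 1) n λ {i} i≤n →
          -- Coefficient i of G(rs) is that of G(r) times a power of s, so it vanishes by the
          -- induction hypothesis.
          R.trans (R.sym (defect-shift 1 i))
                  (R.trans (R.*-congʳ (ih (s≤s i≤n))) (R.zeroˡ _)))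

      step : ∀ n → (∀ {i} → i < n → defect 0 i R.≈ R.0#) → defect 0 n R.≈ R.0#
      step n ih = R.trans (R.trans (R.sym (R.+-identityʳ _)) (R.+-congˡ (R.sym (tail n ih))))
                          (defect-recurrence n)

    decomposition : ∀ h → ζ⟨rs^ h ⟩ + r * const (s ^ suc h) * triple h ≈ 1#
    decomposition h = begin
      e       ≈⟨ ⁻¹-involutive e ⟨
      - - e   ≈⟨ -‿cong (inverseʳ-unique e (- 1#) defect-h≈0) ⟨
      - - 1#  ≈⟨ ⁻¹-involutive 1# ⟩
      1#      ∎
      where
      open GroupProperties +-group using (⁻¹-involutive; inverseʳ-unique)

      e : Series
      e = ζ⟨rs^ h ⟩ + r * const (s ^ suc h) * triple h

      defect-h≈0 : defect h ≈ 0#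
      defect-h≈0 n = R.trans (R.sym (defect-shift h n))
                             (R.trans (R.*-congʳ (defect≈0 n)) (R.zeroˡ _))

    -- This is G(rsʰ⁺¹) = 0 multiplied by s^⌊h/2⌋ C_h, since `descents (3 ℕ.+ h)` unfolds to that
    -- multiplier times three consecutive ζ factors and two powers of s.
    descents-suc : ∀ h →
      descents (suc h) + r * (S * descents (3 ℕ.+ h)) ≈ const (s ^ ⌊ h /2⌋) * descents h
    descents-suc h = begin
      descents (suc h) + r * (S * descents (3 ℕ.+ h))
        ≈⟨ factor r S a c₁ c₂ ζ⟨rs^ 1 ℕ.+ h ⟩ ζ⟨rs^ 2 ℕ.+ h ⟩ ζ⟨rs^ 3 ℕ.+ h ⟩ ⟩
      a * (ζ⟨rs^ suc h ⟩ + r * (S * (c₁ * c₂)) * triple (suc h))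
        ≈⟨ *-congˡ {a} (+-congˡ {ζ⟨rs^ suc h ⟩}
             (*-congʳ {triple (suc h)} (*-congˡ {r} exponent))) ⟩
      a * (ζ⟨rs^ suc h ⟩ + r * const (s ^ (2 ℕ.+ h)) * triple (suc h))
        ≈⟨ *-congˡ {a} (decomposition (suc h)) ⟩
      a * 1#
        ≈⟨ *-identityʳ a ⟩
      a ∎
      where
      a c₁ c₂ : Series
      a  = const (s ^ ⌊ h /2⌋) * descents h
      c₁ = const (s ^ ⌊ 1 ℕ.+ h /2⌋)
      c₂ = const (s ^ ⌊ 2 ℕ.+ h /2⌋)

      open Solver commutativeSemiring
      factor : ∀ r s a c₁ c₂ z₁ z₂ z₃ →
        a * z₁ + r * (s * (c₂ * (c₁ * (a * z₁) * z₂) * z₃))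
        ≈ a * (z₁ + r * (s * (c₁ * c₂)) * (z₁ * z₂ * z₃))
      factor = solve 8 (λ r s a c₁ c₂ z₁ z₂ z₃ →
        a :* z₁ :+ r :* (s :* (c₂ :* (c₁ :* (a :* z₁) :* z₂) :* z₃))
        := a :* (z₁ :+ r :* (s :* (c₁ :* c₂)) :* (z₁ :* z₂ :* z₃))) refl

      -- The two down-step weights fit the functional equation because ⌊(h+2)/2⌋ is ⌈(h+1)/2⌉ by
      -- definition, and the two halves of h+1 add up to it.
      exponent : S * (c₁ * c₂) ≈ const (s ^ (2 ℕ.+ h))
      exponent = begin
        S * (c₁ * c₂)
          ≈⟨ *-congˡ {S} (P.const-*-const _ _) ⟩
        S * const (s ^ ⌊ 1 ℕ.+ h /2⌋ R.* s ^ ⌊ 2 ℕ.+ h /2⌋)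
          ≈⟨ P.const-*-const s _ ⟩
        const (s R.* (s ^ ⌊ 1 ℕ.+ h /2⌋ R.* s ^ ⌊ 2 ℕ.+ h /2⌋))
          ≈⟨ P.const-cong (R.*-congˡ (R.trans
               (R.sym (^-homo-* s ⌊ 1 ℕ.+ h /2⌋ ⌊ 2 ℕ.+ h /2⌋))
               (^-congʳ s (ℕ.⌊n/2⌋+⌈n/2⌉≡n (suc h))))) ⟩
        const (s ^ (2 ℕ.+ h)) ∎

    descents-zero : descents 0 + r * (S * descents 2) ≈ 1#
    descents-zero = begin
      descents 0 + r * (S * descents 2)
        ≈⟨ +-congˡ {descents 0} (expand r S 1# ζ⟨rs^ 0 ⟩ ζ⟨rs^ 1 ⟩ ζ⟨rs^ 2 ⟩) ⟩
      descents 0 + r * (S * 1# * 1#) * triple 0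
        ≈⟨ +-congˡ {descents 0} (*-congʳ {triple 0} (*-congˡ {r} S*1*1≈const[s^1])) ⟩
      descents 0 + r * const (s ^ 1) * triple 0
        ≈⟨ decomposition 0 ⟩
      1# ∎
      where
      open Solver commutativeSemiring
      -- Both ⌊0/2⌋ and ⌊1/2⌋ are 0, so the two powers of s inside `descents 2` compute to one; c
      -- stands for both.
      expand : ∀ r s c z₀ z₁ z₂ →
        r * (s * (c * (c * z₀ * z₁) * z₂)) ≈ r * (s * c * c) * (z₀ * z₁ * z₂)
      expand = solve 6 (λ r s c z₀ z₁ z₂ →
        r :* (s :* (c :* (c :* z₀ :* z₁) :* z₂))
        := r :* (s :* c :* c) :* (z₀ :* z₁ :* z₂)) refl

      S*1*1≈const[s^1] : S * 1# * 1# ≈ const (s ^ 1)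
      S*1*1≈const[s^1] = begin
        S * 1# * 1#    ≈⟨ *-identityʳ (S * 1#) ⟩
        S * 1#         ≈⟨ *-identityʳ S ⟩
        S              ≈⟨ P.const-cong (R.*-identityʳ s) ⟨
        const (s ^ 1)  ∎

-- The area, counted column by column.

length-filter-map : ∀ {a b p} {A : Set a} {B : Set b} {P : Pred B p}
  (P? : Decidable P) (f : A → B) xs →
  length (filter P? (map f xs)) ≡ length (filter (P? ∘ f) xs)
length-filter-map P? f []       = ≡.refl
length-filter-map P? f (x ∷ xs) with P? (f x)
... | yes _ = cong suc (length-filter-map P? f xs)
... | no  _ = length-filter-map P? f xs

length-filter-cartesianProduct : ∀ {a b p} {A : Set a} {B : Set b} {P : Pred (A × B) p}
  (P? : Decidable P) (f : ℕ → A) m (ys : List B) →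
  length (filter P? (cartesianProduct (applyUpTo f m) ys)) ≡
  sum (applyUpTo (λ i → length (filter (λ y → P? (f i , y)) ys)) m)
length-filter-cartesianProduct P? f zero    ys = ≡.refl
length-filter-cartesianProduct P? f (suc m) ys = begin
  length (filter P? (map (f 0 ,_) ys ++ rest))
    ≡⟨ cong length (List.filter-++ P? (map (f 0 ,_) ys) rest) ⟩
  length (filter P? (map (f 0 ,_) ys) ++ filter P? rest)
    ≡⟨ List.length-++ (filter P? (map (f 0 ,_) ys)) ⟩
  length (filter P? (map (f 0 ,_) ys)) ℕ.+ length (filter P? rest)
    ≡⟨ cong₂ ℕ._+_ (length-filter-map P? (f 0 ,_) ys)
                   (length-filter-cartesianProduct P? (f ∘ suc) m ys) ⟩
  sum (applyUpTo (λ i → length (filter (λ y → P? (f i , y)) ys)) (suc m)) ∎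
  where
  open ≡-Reasoning
  rest = cartesianProduct (applyUpTo (f ∘ suc) m) ys

interval? : ∀ a b → Decidable (λ j → a ≤ j × j < b)
interval? a b j = (a ℕ.≤? j) ×-dec (j ℕ.<? b)

pred≤⇒≤suc : ∀ m {n} → ℕ.pred m ≤ n → m ≤ suc n
pred≤⇒≤suc zero    _   = z≤n
pred≤⇒≤suc (suc m) m≤n = s≤s m≤n

-- Dropping 0 from `upTo` shifts the interval down by one, and its lower end stops at 0, whence
-- `pred a`. Truncated subtraction covers empty intervals.
length-filter-interval : ∀ a b n → b ≤ n → length (filter (interval? a b) (upTo n)) ≡ b ∸ a
length-filter-interval a zero n b≤n =
  ≡.trans (cong length (List.filter-none (interval? a 0) (All.universal (λ _ ()) (upTo n))))
          (≡.sym (ℕ.0∸n≡0 a))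
length-filter-interval a (suc b) (suc n) (s≤s b≤n) = begin
  length (filter (interval? a (suc b)) (0 ∷ applyUpTo suc n))
    ≡⟨ cong (λ xs → length (filter (interval? a (suc b)) (0 ∷ xs))) (List.map-upTo suc n) ⟨
  length (filter (interval? a (suc b)) (0 ∷ map suc (upTo n)))
    ≡⟨ head a ⟩
  suc b ∸ a ∎
  where
  open ≡-Reasoning

  shifted : ∀ a → length (filter (interval? a (suc b)) (map suc (upTo n))) ≡ b ∸ ℕ.pred a
  shifted a = begin
    length (filter (interval? a (suc b)) (map suc (upTo n)))
      ≡⟨ length-filter-map (interval? a (suc b)) suc (upTo n) ⟩
    length (filter (interval? a (suc b) ∘ suc) (upTo n))
      ≡⟨ cong length (List.filter-≐ (interval? a (suc b) ∘ suc) (interval? (ℕ.pred a) b)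
           ((λ (p , q) → ℕ.pred-mono-≤ p , ℕ.s≤s⁻¹ q) , (λ (p , q) → pred≤⇒≤suc a p , s≤s q))
           (upTo n)) ⟩
    length (filter (interval? (ℕ.pred a) b) (upTo n))
      ≡⟨ length-filter-interval (ℕ.pred a) b n b≤n ⟩
    b ∸ ℕ.pred a ∎

  head : ∀ a → length (filter (interval? a (suc b)) (0 ∷ map suc (upTo n))) ≡ suc b ∸ a
  head zero    = cong suc (shifted 0)
  head (suc a) = shifted (suc a)

sum-applyUpTo-cong : ∀ {f g : ℕ → ℕ} m → (∀ {i} → i < m → f i ≡ g i) →
  sum (applyUpTo f m) ≡ sum (applyUpTo g m)
sum-applyUpTo-cong zero    f≡g = ≡.refl
sum-applyUpTo-cong (suc m) f≡g = cong₂ ℕ._+_ (f≡g (s≤s z≤n)) (sum-applyUpTo-cong m (f≡g ∘ s≤s))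

height-lowest : ∀ n {i} → i < 2 ℕ.* n → height (lowest n) i ≡ suc ⌊ i /2⌋
height-lowest (suc n) {zero}        i<2n = ≡.refl
height-lowest (suc n) {suc zero}    i<2n = ≡.refl
height-lowest (suc n) {suc (suc i)} i<2n =
  cong suc (height-lowest n (ℕ.s≤s⁻¹ (ℕ.s≤s⁻¹ (subst (3 ℕ.+ i ≤_) (ℕ.*-suc 2 n) i<2n))))

endFrom-≥ : ∀ {x y} μ → x ≤ proj₁ (endFrom (x , y) μ)
endFrom-≥ []      = ℕ.≤-refl
endFrom-≥ (U ∷ μ) = endFrom-≥ μ
endFrom-≥ (D ∷ μ) = ℕ.≤-trans (ℕ.n≤1+n _) (endFrom-≥ μ)

-- Boxes are listed only in rows below n; this bound ensures that no column is cut off.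
height-≤ : ∀ {x y} μ i → y ℕ.+ height μ i ≤ proj₂ (endFrom (x , y) μ)
height-≤         []      i       = ℕ.≤-reflexive (ℕ.+-identityʳ _)
height-≤ {x} {y} (U ∷ μ) i       =
  ℕ.≤-trans (ℕ.≤-reflexive (ℕ.+-suc y (height μ i))) (height-≤ μ i)
height-≤ {x} {y} (D ∷ μ) zero    = ℕ.≤-trans (ℕ.+-monoʳ-≤ y z≤n) (height-≤ {suc x} μ 0)
height-≤         (D ∷ μ) (suc i) = height-≤ μ i

-- The area in the columns x, …, x + m - 1 of a path that continues with μ from (x , y);
-- the lowest path has its down step in column i at height suc ⌊ i /2⌋.
columnArea : ℕ → ℕ → Path → ℕ → ℕ
columnArea x y μ m = sum (applyUpTo (λ i → (y ℕ.+ height μ i) ∸ suc ⌊ x ℕ.+ i /2⌋) m)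

Area≡columnArea : ∀ n μ → endFrom (0 , 0) μ ≡ (2 ℕ.* n , n) →
  Area n μ ≡ columnArea 0 0 μ (2 ℕ.* n)
Area≡columnArea n μ end = ≡.trans
  (length-filter-cartesianProduct (between? (lowest n) μ) id (2 ℕ.* n) (upTo n))
  (sum-applyUpTo-cong (2 ℕ.* n) λ {i} i<2n → ≡.trans
    (length-filter-interval (height (lowest n) i) (height μ i) n
      (subst (height μ i ≤_) (cong proj₂ end) (height-≤ μ i)))
    (cong (height μ i ∸_) (height-lowest n i<2n)))

columnArea-U : ∀ x y μ m → columnArea x y (U ∷ μ) m ≡ columnArea x (suc y) μ m
columnArea-U x y μ m = sum-applyUpTo-cong m λ {i} _ →
  cong (_∸ suc ⌊ x ℕ.+ i /2⌋) (ℕ.+-suc y (height μ i))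

-- The sum x + h is odd, so exactly one of the two halves is rounded. Removing two columns and one
-- row changes neither side, which leaves x = 0 with h odd and x = 1 with h even.
half-difference : ∀ x y {h} → x ℕ.+ suc h ≡ 2 ℕ.* y → y ∸ suc ⌊ x /2⌋ ≡ ⌊ h /2⌋
half-difference zero          (suc y) {h} eq =
  ≡.trans (ℕ.n≡⌈n+n/2⌉ y) (cong ⌊_/2⌋ (≡.sym h≡1+y+y))
  where
  h≡1+y+y : h ≡ suc (y ℕ.+ y)
  h≡1+y+y = ℕ.suc-injective (≡.trans eq (≡.trans (ℕ.*-suc 2 y)
    (cong (λ k → 2 ℕ.+ (y ℕ.+ k)) (ℕ.+-identityʳ y))))
half-difference (suc zero)    (suc y) {h} eq =
  ≡.trans (ℕ.n≡⌊n+n/2⌋ y) (cong ⌊_/2⌋ (≡.sym h≡y+y))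
  where
  h≡y+y : h ≡ y ℕ.+ y
  h≡y+y = ℕ.suc-injective (ℕ.suc-injective (≡.trans eq (≡.trans (ℕ.*-suc 2 y)
    (cong (λ k → 2 ℕ.+ (y ℕ.+ k)) (ℕ.+-identityʳ y)))))
half-difference (suc (suc x)) zero        ()
half-difference (suc (suc x)) (suc y)     eq =
  half-difference x y (ℕ.suc-injective (ℕ.suc-injective (≡.trans eq (ℕ.*-suc 2 y))))

columnArea-D : ∀ x y {h} μ m → x ℕ.+ suc h ≡ 2 ℕ.* y →
  columnArea x y (D ∷ μ) (suc m) ≡ ⌊ h /2⌋ ℕ.+ columnArea (suc x) y μ m
columnArea-D x y μ m eq = cong₂ ℕ._+_
  (≡.trans (cong₂ (λ a b → a ∸ suc ⌊ b /2⌋) (ℕ.+-identityʳ y) (ℕ.+-identityʳ x))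
           (half-difference x y eq))
  (sum-applyUpTo-cong m λ {i} _ → cong (λ b → (y ℕ.+ height μ i) ∸ suc ⌊ b /2⌋) (ℕ.+-suc x i))

-- Dyck conditions from an arbitrary starting point.

IsDyckFrom : ℕ → Point → Path → Set
IsDyckFrom n P μ = endFrom P μ ≡ (2 ℕ.* n , n) × All WeaklyAboveLine (verticesFrom P μ)

height⇒above : ∀ x y {h} → x ℕ.+ h ≡ 2 ℕ.* y → WeaklyAboveLine (x , y)
height⇒above x y {h} eq = subst (x ≤_) eq (ℕ.m≤m+n x h)

isDyckFrom-U : ∀ n {x y h μ} → x ℕ.+ h ≡ 2 ℕ.* y →
  IsDyckFrom n (x , suc y) μ → IsDyckFrom n (x , y) (U ∷ μ)
isDyckFrom-U n {x} {y} eq (end , above) = end , height⇒above x y eq ∷ above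

isDyckFrom-D : ∀ n {x y h μ} → x ℕ.+ h ≡ 2 ℕ.* y →
  IsDyckFrom n (suc x , y) μ → IsDyckFrom n (x , y) (D ∷ μ)
isDyckFrom-D n {x} {y} eq (end , above) = end , height⇒above x y eq ∷ above

isDyckFrom⇒above : ∀ n {P} μ → IsDyckFrom n P μ → WeaklyAboveLine P
isDyckFrom⇒above n []      (_ , above ∷ _) = above
isDyckFrom⇒above n (U ∷ μ) (_ , above ∷ _) = above
isDyckFrom⇒above n (D ∷ μ) (_ , above ∷ _) = above

height-U : ∀ x {h y} → x ℕ.+ h ≡ 2 ℕ.* y → x ℕ.+ (2 ℕ.+ h) ≡ 2 ℕ.* suc y
height-U x {h} {y} eq = begin
  x ℕ.+ (2 ℕ.+ h)     ≡⟨ ℕ.+-suc x (suc h) ⟩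
  suc (x ℕ.+ suc h)   ≡⟨ cong suc (ℕ.+-suc x h) ⟩
  2 ℕ.+ (x ℕ.+ h)     ≡⟨ cong (2 ℕ.+_) eq ⟩
  2 ℕ.+ 2 ℕ.* y       ≡⟨ ℕ.*-suc 2 y ⟨
  2 ℕ.* suc y         ∎
  where open ≡-Reasoning

height-D : ∀ x y {h} → x ℕ.+ suc h ≡ 2 ℕ.* y → suc x ℕ.+ h ≡ 2 ℕ.* y
height-D x y {h} eq = ≡.trans (≡.sym (ℕ.+-suc x h)) eq

-- Height 0 only places the end on the line; the number of steps singles out (2n , n), as x = 2y
-- turns x + y = 3n into 3y = 3n.
isDyckFrom-[] : ∀ n {x y} → x ℕ.+ 0 ≡ 2 ℕ.* y → x ℕ.+ y ℕ.+ 0 ≡ 3 ℕ.* n →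
  IsDyckFrom n (x , y) []
isDyckFrom-[] n {x} {y} eq len =
  cong₂ _,_ (≡.trans x≡2y (cong (2 ℕ.*_) y≡n)) y≡n , ℕ.≤-reflexive x≡2y ∷ []
  where
  open ≡-Reasoning
  x≡2y : x ≡ 2 ℕ.* y
  x≡2y = ≡.trans (≡.sym (ℕ.+-identityʳ x)) eq

  y≡n : y ≡ n
  y≡n = ℕ.*-cancelˡ-≡ y n 3 (begin
    3 ℕ.* y        ≡⟨ ℕ.+-comm y (2 ℕ.* y) ⟩
    2 ℕ.* y ℕ.+ y  ≡⟨ cong (ℕ._+ y) x≡2y ⟨
    x ℕ.+ y        ≡⟨ ℕ.+-identityʳ _ ⟨
    x ℕ.+ y ℕ.+ 0  ≡⟨ len ⟩
    3 ℕ.* n        ∎)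

paths-length : ∀ k → All (λ μ → length μ ≡ k) (paths k)
paths-length zero    = ≡.refl ∷ []
paths-length (suc k) = All.++⁺ (All.map⁺ (All.map (cong suc) (paths-length k)))
                               (All.map⁺ (All.map (cong suc) (paths-length k)))

-- Area-weighted sums over paths.

module PathWeights {c ℓ} (R : CommutativeRing c ℓ) (s : CommutativeRing.Carrier R) where
  open CommutativeRing R
  open Exp commutativeSemiring using (_^_; ^-congʳ; ^-homo-*)
  open ≈-Reasoning setoid

  ∑ : ∀ {a} {A : Set a} → (A → Carrier) → List A → Carrier
  ∑ f xs = foldr _+_ 0# (map f xs)

  ∑-++ : ∀ {a} {A : Set a} (f : A → Carrier) xs ys → ∑ f (xs ++ ys) ≈ ∑ f xs + ∑ f ys
  ∑-++ f []       ys = sym (+-identityˡ _)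
  ∑-++ f (x ∷ xs) ys = trans (+-congˡ (∑-++ f xs ys)) (sym (+-assoc _ _ _))

  ∑-map : ∀ {a b} {A : Set a} {B : Set b} (f : B → Carrier) (g : A → B) xs →
    ∑ f (map g xs) ≈ ∑ (f ∘ g) xs
  ∑-map f g xs = reflexive (cong (foldr _+_ 0#) (≡.sym (List.map-∘ xs)))

  ∑-* : ∀ {a} {A : Set a} x (f : A → Carrier) xs → ∑ (λ y → x * f y) xs ≈ x * ∑ f xs
  ∑-* x f []       = sym (zeroʳ x)
  ∑-* x f (y ∷ ys) = trans (+-congˡ (∑-* x f ys)) (sym (distribˡ _ _ _))

  ∑-zero : ∀ {a} {A : Set a} (xs : List A) → ∑ (λ _ → 0#) xs ≈ 0#
  ∑-zero []       = refl
  ∑-zero (x ∷ xs) = trans (+-identityˡ _) (∑-zero xs)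

  -- Trades the filter for a weight that vanishes off P, so that the sum can range over all `paths`
  -- and follow their first-step recursion.
  ∑-filter : ∀ {a p} {A : Set a} {P : Pred A p} (P? : Decidable P) {f g : A → Carrier} {xs} →
    All (λ x → (P x → f x ≈ g x) × (¬ P x → g x ≈ 0#)) xs →
    ∑ f (filter P? xs) ≈ ∑ g xs
  ∑-filter P? []                             = refl
  ∑-filter P? (_∷_ {x = x} (f≈g , g≈0) rest) with P? x
  ... | yes p = +-cong (f≈g p) (∑-filter P? rest)
  ... | no ¬p = trans (∑-filter P? rest) (sym (trans (+-congʳ (g≈0 ¬p)) (+-identityˡ _)))

  -- A path is read from height h = 2y - x.  A down step from height suc h
  -- has ⌊ h /2⌋ boxes between it and the lowest path; a path that goes below
  -- height 0 or does not end there has weight 0.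
  weight : ℕ → Path → Carrier
  weight h       (U ∷ μ) = weight (2 ℕ.+ h) μ
  weight zero    []      = 1#
  weight (suc h) []      = 0#
  weight zero    (D ∷ μ) = 0#
  weight (suc h) (D ∷ μ) = s ^ ⌊ h /2⌋ * weight h μ

  totalWeight : ℕ → ℕ → Carrier
  totalWeight h k = ∑ (weight h) (paths k)

  totalWeight-zero-suc : ∀ k → totalWeight 0 (suc k) ≈ totalWeight 2 k
  totalWeight-zero-suc k = begin
    ∑ (weight 0) (map (U ∷_) (paths k) ++ map (D ∷_) (paths k))
      ≈⟨ ∑-++ (weight 0) (map (U ∷_) (paths k)) _ ⟩
    ∑ (weight 0) (map (U ∷_) (paths k)) + ∑ (weight 0) (map (D ∷_) (paths k))
      ≈⟨ +-cong (∑-map (weight 0) (U ∷_) (paths k))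
                (trans (∑-map (weight 0) (D ∷_) (paths k)) (∑-zero (paths k))) ⟩
    totalWeight 2 k + 0#
      ≈⟨ +-identityʳ _ ⟩
    totalWeight 2 k ∎

  totalWeight-suc-suc : ∀ h k →
    totalWeight (suc h) (suc k) ≈ totalWeight (3 ℕ.+ h) k + s ^ ⌊ h /2⌋ * totalWeight h k
  totalWeight-suc-suc h k = begin
    ∑ (weight (suc h)) (map (U ∷_) (paths k) ++ map (D ∷_) (paths k))
      ≈⟨ ∑-++ (weight (suc h)) (map (U ∷_) (paths k)) _ ⟩
    ∑ (weight (suc h)) (map (U ∷_) (paths k)) + ∑ (weight (suc h)) (map (D ∷_) (paths k))
      ≈⟨ +-cong (∑-map (weight (suc h)) (U ∷_) (paths k))
                (trans (∑-map (weight (suc h)) (D ∷_) (paths k))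
                       (∑-* (s ^ ⌊ h /2⌋) (weight h) (paths k))) ⟩
    totalWeight (3 ℕ.+ h) k + s ^ ⌊ h /2⌋ * totalWeight h k ∎

  -- Both equations are invariants of taking a step: h stays the height, and steps taken plus steps
  -- left stay 3n. A path whose weight is not zero by definition ends at height 0 without crossing
  -- the line, and the length makes it Dyck.
  weight-nonDyck : ∀ n {x y h} μ → x ℕ.+ h ≡ 2 ℕ.* y → x ℕ.+ y ℕ.+ length μ ≡ 3 ℕ.* n →
    ¬ IsDyckFrom n (x , y) μ → weight h μ ≈ 0#
  weight-nonDyck n {h = zero}      []      eq len ¬dyck =
    contradiction (isDyckFrom-[] n eq len) ¬dyck
  weight-nonDyck n {h = suc h}     []      eq len ¬dyck = refl
  weight-nonDyck n {x} {y}         (U ∷ μ) eq len ¬dyck = weight-nonDyck n μ (height-U x eq)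
    (≡.trans (≡.trans (cong (ℕ._+ length μ) (ℕ.+-suc x y))
                      (≡.sym (ℕ.+-suc (x ℕ.+ y) (length μ)))) len)
    (¬dyck ∘ isDyckFrom-U n eq)
  weight-nonDyck n {h = zero}      (D ∷ μ) eq len ¬dyck = refl
  weight-nonDyck n {x} {y} {suc h} (D ∷ μ) eq len ¬dyck =
    trans (*-congˡ (weight-nonDyck n μ (height-D x y eq)
      (≡.trans (≡.sym (ℕ.+-suc (x ℕ.+ y) (length μ))) len) (¬dyck ∘ isDyckFrom-D n eq))) (zeroʳ _)

  -- Here m is the number of columns left: each down step uses up one of them and pays for its
  -- boxes, while up steps change neither.
  weight-dyck : ∀ n {x y h} μ m → x ℕ.+ h ≡ 2 ℕ.* y → x ℕ.+ m ≡ 2 ℕ.* n →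
    IsDyckFrom n (x , y) μ → s ^ columnArea x y μ m ≈ weight h μ
  weight-dyck n {x} {h = zero} [] zero eq cols dyck = refl
  weight-dyck n {x} {h = zero} [] (suc m) eq cols (≡.refl , _) =
    contradiction (ℕ.+-cancelˡ-≡ x (suc m) 0 (≡.trans cols (≡.sym (ℕ.+-identityʳ x)))) λ ()
  weight-dyck n {x} {h = suc h} [] m eq cols (≡.refl , _) =
    contradiction (ℕ.+-cancelˡ-≡ x (suc h) 0 (≡.trans eq (≡.sym (ℕ.+-identityʳ x)))) λ ()
  weight-dyck n {x} {y} {h} (U ∷ μ) m eq cols (end , _ ∷ above) =
    trans (^-congʳ s (columnArea-U x y μ m)) (weight-dyck n μ m (height-U x eq) cols (end , above))
  -- With no column left, x is already 2n, and a path never moves back to the left.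
  weight-dyck n {x} (D ∷ μ) zero eq cols (end , _) = contradiction
    (subst (suc x ≤_) (≡.trans (cong proj₁ end) (≡.trans (≡.sym cols) (ℕ.+-identityʳ x)))
           (endFrom-≥ μ))
    (ℕ.n≮n x)
  -- A down step from height 0 would land below the line.
  weight-dyck n {x} {y} {zero} (D ∷ μ) (suc m) eq cols (end , _ ∷ above) = contradiction
    (subst (suc x ≤_) (≡.trans (≡.sym eq) (ℕ.+-identityʳ x))
           (isDyckFrom⇒above n μ (end , above)))
    (ℕ.n≮n x)
  weight-dyck n {x} {y} {suc h} (D ∷ μ) (suc m) eq cols (end , _ ∷ above) = begin
    s ^ columnArea x y (D ∷ μ) (suc m)
      ≈⟨ ^-congʳ s (columnArea-D x y μ m eq) ⟩
    s ^ (⌊ h /2⌋ ℕ.+ columnArea (suc x) y μ m)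
      ≈⟨ ^-homo-* s ⌊ h /2⌋ _ ⟩
    s ^ ⌊ h /2⌋ * s ^ columnArea (suc x) y μ m
      ≈⟨ *-congˡ (weight-dyck n μ m (height-D x y eq)
           (≡.trans (≡.sym (ℕ.+-suc x m)) cols) (end , above)) ⟩
    s ^ ⌊ h /2⌋ * weight h μ ∎

  ∑-Area : ∀ n → ∑ (λ μ → s ^ Area n μ) (Dyck n) ≈ totalWeight 0 (3 ℕ.* n)
  ∑-Area n = ∑-filter (isDyck? n) (All.map
    (λ {μ} len →
      (λ dyck → trans (^-congʳ s (Area≡columnArea n μ (proj₁ dyck)))
                      (weight-dyck n μ (2 ℕ.* n) ≡.refl ≡.refl dyck)) ,
      weight-nonDyck n μ ≡.refl len)
    (paths-length (3 ℕ.* n)))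

-- Coefficients of C_h as weighted path counts.

module DyckSeries {c ℓ} (R : CommutativeRing c ℓ) (s : CommutativeRing.Carrier R)
  (z : PowerSeries.Series (CommutativeRing.rawRing R)) where
  open CommutativeRing R hiding (zero)
  open PowerSeries rawRing using (_*ₛ_; const; r; _≈ₛ_)
  open PowerSeriesProperties R using (r-*ₛ-zero; r-*ₛ-suc; const-*ₛ)
  open Exp commutativeSemiring using (_^_)
  open RingProperties ring using (-‿distribˡ-*)
  open PathWeights R s
  open ZetaSeries R s z
  open ≈-Reasoning setoid

  -- A step lowers the height by at most one, so fewer than h steps cannot reach 0. This removes the
  -- up-step term from the constant coefficients.
  totalWeight-short : ∀ {h k} → k < h → totalWeight h k ≈ 0#
  totalWeight-short {suc h} {zero}  _         = +-identityʳ 0#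
  totalWeight-short {suc h} {suc k} (s≤s k<h) = begin
    totalWeight (suc h) (suc k)
      ≈⟨ totalWeight-suc-suc h k ⟩
    totalWeight (3 ℕ.+ h) k + s ^ ⌊ h /2⌋ * totalWeight h k
      ≈⟨ +-cong (totalWeight-short (ℕ.<-≤-trans k<h (ℕ.m≤n+m h 3)))
                (*-congˡ (totalWeight-short k<h)) ⟩
    0# + s ^ ⌊ h /2⌋ * 0#
      ≈⟨ trans (+-identityˡ _) (zeroʳ _) ⟩
    0# ∎

  move-+ : ∀ {a b d} → a + b ≈ d → a ≈ - b + d
  move-+ {a} {b} {d} eq = begin
    a              ≈⟨ +-identityʳ a ⟨
    a + 0#         ≈⟨ +-congˡ (-‿inverseʳ b) ⟨
    a + (b + - b)  ≈⟨ +-assoc a b (- b) ⟨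
    a + b + - b    ≈⟨ +-congʳ eq ⟩
    d + - b        ≈⟨ +-comm d (- b) ⟩
    - b + d        ∎

  module _ (equation : ZetaEquation rawRing s 1# z) where
    -- Going from height h to 0 with n up steps takes h + 2n down steps, so h + 3n steps in all. The
    -- up-step term lowers n but raises the height, the down-step term keeps n and lowers h; hence
    -- an induction on n for all h, with one on h inside.
    descents-coefficient : ∀ n h → descents h n ≈ (- s) ^ n * totalWeight h (h ℕ.+ 3 ℕ.* n)
    descents-coefficient zero zero = begin
      descents 0 0
        ≈⟨ +-identityʳ _ ⟨
      descents 0 0 + 0#
        ≈⟨ +-congˡ (r-*ₛ-zero (const s *ₛ descents 2)) ⟨
      descents 0 0 + (r *ₛ (const s *ₛ descents 2)) 0
        ≈⟨ descents-zero equation 0 ⟩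
      1#
        ≈⟨ +-identityʳ 1# ⟨
      totalWeight 0 0
        ≈⟨ *-identityˡ _ ⟨
      1# * totalWeight 0 0 ∎
    descents-coefficient zero (suc h) = begin
      descents (suc h) 0
        ≈⟨ +-identityʳ _ ⟨
      descents (suc h) 0 + 0#
        ≈⟨ +-congˡ (r-*ₛ-zero (const s *ₛ descents (3 ℕ.+ h))) ⟨
      descents (suc h) 0 + (r *ₛ (const s *ₛ descents (3 ℕ.+ h))) 0
        ≈⟨ descents-suc equation h 0 ⟩
      (const (s ^ ⌊ h /2⌋) *ₛ descents h) 0
        ≈⟨ const-*ₛ (s ^ ⌊ h /2⌋) (descents h) 0 ⟩
      s ^ ⌊ h /2⌋ * descents h 0
        ≈⟨ *-congˡ (trans (descents-coefficient zero h) (*-identityˡ _)) ⟩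
      s ^ ⌊ h /2⌋ * totalWeight h (h ℕ.+ 0)
        ≈⟨ +-identityˡ _ ⟨
      0# + s ^ ⌊ h /2⌋ * totalWeight h (h ℕ.+ 0)
        ≈⟨ +-congʳ (totalWeight-short
             (ℕ.≤-<-trans (ℕ.≤-reflexive (ℕ.+-identityʳ h)) (ℕ.m<n+m h (s≤s z≤n)))) ⟨
      totalWeight (3 ℕ.+ h) (h ℕ.+ 0) + s ^ ⌊ h /2⌋ * totalWeight h (h ℕ.+ 0)
        ≈⟨ totalWeight-suc-suc h (h ℕ.+ 0) ⟨
      totalWeight (suc h) (suc h ℕ.+ 0)
        ≈⟨ *-identityˡ _ ⟨
      1# * totalWeight (suc h) (suc h ℕ.+ 0) ∎
    descents-coefficient (suc n) h = go h
      where
      -- Each up step contributes one factor -s and, through r, one unit of the index.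
      up : ∀ h → - (r *ₛ (const s *ₛ descents h)) (suc n)
               ≈ (- s) ^ suc n * totalWeight h (h ℕ.+ 3 ℕ.* n)
      up h = begin
        - (r *ₛ (const s *ₛ descents h)) (suc n)
          ≈⟨ -‿cong (trans (r-*ₛ-suc (const s *ₛ descents h) n) (const-*ₛ s (descents h) n)) ⟩
        - (s * descents h n)
          ≈⟨ -‿distribˡ-* s (descents h n) ⟩
        - s * descents h n
          ≈⟨ *-congˡ (descents-coefficient n h) ⟩
        - s * ((- s) ^ n * totalWeight h (h ℕ.+ 3 ℕ.* n))
          ≈⟨ *-assoc _ _ _ ⟨
        (- s) ^ suc n * totalWeight h (h ℕ.+ 3 ℕ.* n) ∎

      go : ∀ h → descents h (suc n) ≈ (- s) ^ suc n * totalWeight h (h ℕ.+ 3 ℕ.* suc n)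
      go zero = begin
        descents 0 (suc n)
          ≈⟨ move-+ (descents-zero equation (suc n)) ⟩
        - (r *ₛ (const s *ₛ descents 2)) (suc n) + 0#
          ≈⟨ trans (+-identityʳ _) (up 2) ⟩
        (- s) ^ suc n * totalWeight 2 (2 ℕ.+ 3 ℕ.* n)
          ≈⟨ *-congˡ (totalWeight-zero-suc (2 ℕ.+ 3 ℕ.* n)) ⟨
        (- s) ^ suc n * totalWeight 0 (3 ℕ.+ 3 ℕ.* n)
          ≈⟨ *-congˡ (reflexive (cong (totalWeight 0) (ℕ.*-suc 3 n))) ⟨
        (- s) ^ suc n * totalWeight 0 (3 ℕ.* suc n) ∎
      go (suc h) = begin
        descents (suc h) (suc n)
          ≈⟨ move-+ (descents-suc equation h (suc n)) ⟩
        - (r *ₛ (const s *ₛ descents (3 ℕ.+ h))) (suc n) + (const w *ₛ descents h) (suc n)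
          ≈⟨ +-cong (up (3 ℕ.+ h)) (trans (const-*ₛ _ (descents h) (suc n)) (*-congˡ (go h))) ⟩
        σ * totalWeight (3 ℕ.+ h) (3 ℕ.+ h ℕ.+ 3 ℕ.* n) + w * (σ * totalWeight h k)
          ≈⟨ +-cong (*-congˡ (reflexive (cong (totalWeight (3 ℕ.+ h)) k≡)))
                    (trans (sym (*-assoc _ _ _)) (trans (*-congʳ (*-comm _ _)) (*-assoc _ _ _))) ⟩
        σ * totalWeight (3 ℕ.+ h) k + σ * (w * totalWeight h k)
          ≈⟨ distribˡ _ _ _ ⟨
        σ * (totalWeight (3 ℕ.+ h) k + w * totalWeight h k)
          ≈⟨ *-congˡ (totalWeight-suc-suc h k) ⟨
        σ * totalWeight (suc h) (suc k) ∎
        where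
        σ = (- s) ^ suc n
        w = s ^ ⌊ h /2⌋
        k = h ℕ.+ 3 ℕ.* suc n

        k≡ : 3 ℕ.+ h ℕ.+ 3 ℕ.* n ≡ k
        k≡ = ≡.trans (cong (ℕ._+ 3 ℕ.* n) (ℕ.+-comm 3 h))
               (≡.trans (ℕ.+-assoc h 3 (3 ℕ.* n)) (cong (h ℕ.+_) (≡.sym (ℕ.*-suc 3 n))))

    series≈dyck : z ≈ₛ λ n → (- s) ^ n * ∑ (λ μ → s ^ Area n μ) (Dyck n)
    series≈dyck n = begin
      z n                                          ≈⟨ ζ⟨rs^0⟩ n ⟨
      descents 0 n                                 ≈⟨ descents-coefficient n 0 ⟩
      (- s) ^ n * totalWeight 0 (3 ℕ.* n)          ≈⟨ *-congˡ (∑-Area n) ⟨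
      (- s) ^ n * ∑ (λ μ → s ^ Area n μ) (Dyck n) ∎

-- Specialisation to integer coefficients.

proposition4p14 : (ζ : ℤ[m,s]⟦r⟧.Series) → FunctionalEquation ζ →
    atm=1 ζ ℤ[s]⟦r⟧.≈ₛ dyckSeries
proposition4p14 ζ equation =
  DyckSeries.series≈dyck ℤ[s]-ring ℤ[s].X (atm=1 ζ)
    -- Evaluation at m = 1 sends the constant polynomial `s₀` to s and the variable m to 1.
    (zetaEquation-homo ℤ[s]-ring At1.eval-isRingHomomorphism
      s₀ ℤ[m,s].X ζ {ℤ[s].X} {ℤ[s].const (CommutativeRing.1# +-*-commutativeRing)}
      (At1.eval-const ℤ[s].X) At1.eval-X equation)
  where
  ℤ[s]-ring = PolynomialProperties.commutativeRing +-*-commutativeRing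
  module At1 = PolynomialProperties.Evaluation ℤ[s]-ring (CommutativeRing.1# ℤ[s]-ring)
  s₀ = ℤ[m,s].const ℤ[s].X
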